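{- Let $N=(\Gamma,B)$ be a network. The Dirichlet matroid $M(N)$ is (Tutte) 3-connected if and only if the graph $\Gamma\setminus B$ is connected and the graph $\hat\Gamma$, obtained from $\Gamma$ by adding an edge between every pair of boundary nodes, is 3-connected.
   Context: A network $N=(\Gamma,B)$ consists of a finite connected graph $\Gamma=(V,E)$ with no loops or multiple edges and a set $B\subsetneq V$ of at least 2 vertices (boundary nodes), no two of which are adjacent; vertices in $V\setminus B$ are interior. The Dirichlet matroid $M(N)$: fix an injective $u:B\to\mathbb{R}$ and a new symbol $e_0\notin E$; in $\mathbb{R}^{(V\setminus B)\cup\{0\}}$ assign to each edge $ij$ with $i,j$ interior the vector $\mathbf{e}_i-\mathbf{e}_j$, to each edge $ij$ with $i$ interior and $j\in B$ the vector $\mathbf{e}_i-u(j)\mathbf{e}_0$, and to $e_0$ the vector $\mathbf{e}_0$; $M(N)$ is the matroid of linear independence of these vectors on $E\cup\{e_0\}$ (independent of the choice of injective $u$). $\Gamma\setminus B$ denotes the graph obtained by deleting the boundary nodes and incident edges.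
   Formalization: The injective function u on the boundary nodes takes rational rather than real values and linear independence is over the rationals; the Dirichlet matroid does not depend on the choice of injective u. Graph 3-connectivity is in Tutte's sense. -}

module Defs where

open import Data.Nat using (ℕ; zero; suc; _+_; _≤_; _<_)
open import Data.Bool using (Bool; true; false; _∧_; _∨_; not; if_then_else_)
open import Data.Fin using (Fin; zero; suc; _≟_; splitAt; toℕ)
open import Data.Fin.Subset using (Subset; _∈_; _∉_; _⊆_; ∁; ⊤; ∣_∣)
open import Data.Vec using (Vec; tabulate)
open import Data.List using (List; []; _∷_; length; lookup; filter; allFin; concatMap; map)
open import Data.Product using (Σ; _×_; _,_; ∃; ∃-syntax)
open import Data.Sum using (_⊎_)
open import Data.Rational using (ℚ; 0ℚ; 1ℚ; _*_; -_) renaming (_+_ to _+ℚ_)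
open import Relation.Binary.PropositionalEquality using (_≡_; _≢_)
open import Relation.Nullary.Decidable using (⌊_⌋)

record Graph : Set where
  field
    n   : ℕ
    m   : ℕ
    src : Fin m → Fin n
    tgt : Fin m → Fin n
open Graph public

Simple : Graph → Set
Simple G = (∀ e → src G e ≢ tgt G e)
         × (∀ e e' → ((src G e ≡ src G e' × tgt G e ≡ tgt G e')
                      ⊎ (src G e ≡ tgt G e' × tgt G e ≡ src G e')) → e ≡ e')

data Walk (G : Graph) (ok : Fin (n G) → Set) : Fin (n G) → Fin (n G) → Set where
  here : ∀ {v} → ok v → Walk G ok v v
  stepF : ∀ {w} (e : Fin (m G)) → ok (src G e) → Walk G ok (tgt G e) w → Walk G ok (src G e) w
  stepB : ∀ {w} (e : Fin (m G)) → ok (tgt G e) → Walk G ok (src G e) w → Walk G ok (tgt G e) w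

InducedConnected : (G : Graph) → (Fin (n G) → Set) → Set
InducedConnected G ok = (∃[ v ] ok v) × (∀ u v → ok u → ok v → Walk G ok u v)

Connected : Graph → Set
Connected G = InducedConnected G (λ _ → Data.Unit.⊤)
  where import Data.Unit

-- Tutte connectivity of graphs (Tutte's definition, as in Oxley §8.1):
-- a k-separation of G is a partition (X , E - X) of the edge set with
-- |X| ≥ k, |E - X| ≥ k and exactly k vertices incident both to an edge of
-- X and to an edge of E - X.  G is 3-connected if it is connected and has
-- no k-separation for k < 3.

incident : (G : Graph) → Fin (m G) → Fin (n G) → Bool
incident G e v = ⌊ src G e ≟ v ⌋ ∨ ⌊ tgt G e ≟ v ⌋

anyFin : ∀ {k} → (Fin k → Bool) → Bool
anyFin {zero} f = false
anyFin {suc k} f = f zero ∨ anyFin (λ i → f (suc i))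

verts : (G : Graph) → Subset (m G) → Subset (n G)
verts G X = tabulate (λ v → anyFin (λ e → Data.Vec.lookup X e ∧ incident G e v))
  where import Data.Vec

sharedVerts : (G : Graph) → Subset (m G) → Subset (n G)
sharedVerts G X = tabulate (λ v → Data.Vec.lookup (verts G X) v ∧ Data.Vec.lookup (verts G (∁ X)) v)
  where import Data.Vec

GraphSeparation : (G : Graph) → ℕ → Subset (m G) → Set
GraphSeparation G k X = (k ≤ ∣ X ∣) × (k ≤ ∣ ∁ X ∣) × (∣ sharedVerts G X ∣ ≡ k)

GraphTutte3Connected : Graph → Set
GraphTutte3Connected G =
  Connected G × (∀ (k : ℕ) (X : Subset (m G)) → 1 ≤ k → k < 3 → GraphSeparation G k X → Data.Empty.⊥)
  where import Data.Empty

∑ : ∀ {k} → (Fin k → ℚ) → ℚ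
∑ {zero} f = 0ℚ
∑ {suc k} f = f zero +ℚ ∑ (λ i → f (suc i))

LinIndep : ∀ {g d} → (Fin g → Fin d → ℚ) → Subset g → Set
LinIndep {g} {d} v X =
  (c : Fin g → ℚ) → (∀ k → k ∉ X → c k ≡ 0ℚ)
  → (∀ t → ∑ (λ k → c k * v k t) ≡ 0ℚ) → ∀ k → c k ≡ 0ℚ

IsRank : ∀ {g} → (Subset g → Set) → Subset g → ℕ → Set
IsRank {g} Ind X r =
  (Σ (Subset g) λ Y → Y ⊆ X × Ind Y × ∣ Y ∣ ≡ r)
  × (∀ Y → Y ⊆ X → Ind Y → ∣ Y ∣ ≤ r)

MatroidSeparation : ∀ {g} → (Subset g → Set) → ℕ → Subset g → Set
MatroidSeparation {g} Ind k X =
  (k ≤ ∣ X ∣) × (k ≤ ∣ ∁ X ∣)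
  × Σ ℕ λ a → Σ ℕ λ b → Σ ℕ λ c →
      IsRank Ind X a × IsRank Ind (∁ X) b × IsRank Ind ⊤ c × (a + b < c + k)

Matroid3Connected : ∀ {g} → (Subset g → Set) → Set
Matroid3Connected {g} Ind =
  ∀ (k : ℕ) (X : Subset g) → 1 ≤ k → k < 3 → MatroidSeparation Ind k X → Data.Empty.⊥
  where import Data.Empty

record Network : Set where
  field
    Γ  : Graph
    isB : Fin (n Γ) → Bool
open Network public

Bnd : (N : Network) → Fin (n (Γ N)) → Set
Bnd N v = isB N v ≡ true

Int : (N : Network) → Fin (n (Γ N)) → Set
Int N v = isB N v ≡ false

IsNetwork : Network → Set
IsNetwork N =
  Simple (Γ N) × Connected (Γ N)
  × (Σ _ λ a → Σ _ λ b → a ≢ b × Bnd N a × Bnd N b)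
  × (∃[ v ] Int N v)
  × (∀ e → Bnd N (src (Γ N) e) → Bnd N (tgt (Γ N) e) → Data.Empty.⊥)
  where import Data.Empty

InteriorConnected : Network → Set
InteriorConnected N = InducedConnected (Γ N) (Int N)

-- Dirichlet matroid.  Coordinates: Fin (suc n); zero is the coordinate 0,
-- suc i is the coordinate e_i (only interior i are ever used).
-- Ground set: Fin (suc m); zero is e₀, suc e is the edge e.
unit : ∀ {d} → Fin d → Fin d → ℚ
unit i t = if ⌊ i ≟ t ⌋ then 1ℚ else 0ℚ

edgeVec : (N : Network) → (Fin (n (Γ N)) → ℚ) → Fin (m (Γ N)) → Fin (suc (n (Γ N))) → ℚ
edgeVec N u e t with isB N (src (Γ N) e) | isB N (tgt (Γ N) e)
... | false | false = unit (suc (src (Γ N) e)) t +ℚ (- unit (suc (tgt (Γ N) e)) t)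
... | false | true  = unit (suc (src (Γ N) e)) t +ℚ (- (u (tgt (Γ N) e) * unit zero t))
... | true  | false = unit (suc (tgt (Γ N) e)) t +ℚ (- (u (src (Γ N) e) * unit zero t))
... | true  | true  = 0ℚ   -- never occurs in a network

dirichletVec : (N : Network) → (Fin (n (Γ N)) → ℚ) → Fin (suc (m (Γ N))) → Fin (suc (n (Γ N))) → ℚ
dirichletVec N u zero    = unit zero
dirichletVec N u (suc e) = edgeVec N u e

DirichletIndep : (N : Network) → (Fin (n (Γ N)) → ℚ) → Subset (suc (m (Γ N))) → Set
DirichletIndep N u = LinIndep (dirichletVec N u)

InjectiveOnB : (N : Network) → (Fin (n (Γ N)) → ℚ) → Set
InjectiveOnB N u = ∀ a b → Bnd N a → Bnd N b → u a ≡ u b → a ≡ b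

boundaryPairs : (N : Network) → List (Fin (n (Γ N)) × Fin (n (Γ N)))
boundaryPairs N =
  concatMap (λ a → concatMap (λ b →
    if isB N a ∧ isB N b ∧ ⌊ toℕ a Data.Nat.<? toℕ b ⌋ then (a , b) ∷ [] else [])
    (allFin _)) (allFin _)
  where import Data.Nat

hatΓ : Network → Graph
hatΓ N = record
  { n = n (Γ N)
  ; m = m (Γ N) + length (boundaryPairs N)
  ; src = λ e → [ src (Γ N) , (λ i → Data.Product.proj₁ (lookup (boundaryPairs N) i)) ]′ (splitAt (m (Γ N)) e)
  ; tgt = λ e → [ tgt (Γ N) , (λ i → Data.Product.proj₂ (lookup (boundaryPairs N) i)) ]′ (splitAt (m (Γ N)) e)
  }
  where import Data.Product
        open import Data.Sum using ([_,_]′)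

{-# OPTIONS --safe #-}
module Submission where

-- Let X and Y be complementary sets of elements of M(N), with e₀ in Y.  A functional φ on the ambient space
-- is a potential on V that equals φ₀ u on B; it kills an edge iff it takes the same value at both ends.
--
-- If r(X) + r(Y) < r(M) + k, counting unknowns and equations shows that any k test functions admit a
-- nontrivial combination φ + ψ with φ constant along X, and ψ constant along Y and zero on B.  When φ + ψ
-- vanishes off {s , t}, φ is constant along the edges of Γ̂ avoiding s and t; if it separates an X-neighbour
-- of s from a Y-neighbour of s, its level sets yield a 1- or 2-separation of Γ̂.  Interior connectivity
-- provides an interior vertex s meeting both X and Y, and the functional e₀* together with s forces either a
-- separation at s alone or a φ that is X-constant and injective on B, so that X links no two boundary nodes.
-- Testing with such pairs of vertices shared by X and Y leaves at most two shared vertices.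
--
-- Conversely r(X) + r(Y) − r(M) = dim (span X ∩ span Y).  For X the edges meeting a component of Γ ∖ B, that
-- intersection lies on the e₀-axis; for a k-separation of Γ̂ with k < 3 the boundary clique lies on one side,
-- and the intersection lies in the span of e₀ and the shared interior vertices.  In both cases the potentials
-- constant along X cut its dimension below k (or below 1 if X is a single edge).

open import Defs
open import Algebra.Properties.Group using (∙-cancelʳ)
open import Data.Bool using (Bool; true; false; if_then_else_; _∧_; not)
open import Data.Bool.Properties using (∧-comm; not-involutive)
open import Data.Empty using (⊥-elim) renaming (⊥ to Absurd)
open import Data.Fin using (Fin; zero; suc; _≟_; _↑ˡ_; _↑ʳ_; splitAt; toℕ)
open import Data.Fin.Properties using (any?; splitAt-↑ˡ; splitAt-↑ʳ; splitAt⁻¹-↑ˡ; splitAt⁻¹-↑ʳ; suc-injective; toℕ-injective; ↑ˡ-injective)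
open import Data.Fin.Subset using (Subset; _∈_; _∉_; _⊆_; ∁; ⊤; ⊥; ∣_∣; _-_; _∪_; Nonempty; ⁅_⁆)
open import Data.Fin.Subset.Properties
open import Data.List as List using (List)
import Data.List.Membership.Propositional as L
import Data.List.Membership.Propositional.Properties as Lₚ
import Data.List.Relation.Unary.All as LAll
import Data.List.Relation.Unary.All.Properties as LAllₚ
open import Data.List.Relation.Unary.AllPairs as AllPairs using ([]; _∷_)
import Data.List.Relation.Unary.AllPairs.Properties as AllPairsₚ
open import Data.List.Relation.Unary.Any using (here; there; index; satisfied)
import Data.List.Relation.Unary.Any.Properties as Anyₚ
open import Data.List.Relation.Unary.Unique.Propositional using (Unique)
import Data.List.Relation.Unary.Unique.Propositional.Properties as Uniqueₚ
open import Data.Nat using (ℕ; zero; suc; _≤_; _<_; z≤n; s≤s) renaming (_+_ to _+ₙ_)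
import Data.Nat.Properties as ℕₚ
open import Data.Product using (Σ; _×_; _,_; ∃; proj₁; proj₂)
open import Data.Rational using (ℚ; 0ℚ; 1ℚ; _*_; -_; _+_; 1/_; ≢-nonZero)
import Data.Rational.Properties as ℚₚ
open import Data.Rational.Solver using (module +-*-Solver)
open +-*-Solver using (_:+_; _:*_; :-_; _:=_; con) renaming (solve to ℚsolve)
open import Data.Sum using (_⊎_; inj₁; inj₂; [_,_]′; swap)
open import Data.Unit using (tt) renaming (⊤ to Unit)
open import Data.Vec using (Vec; []; _∷_; here; there; map; _++_; lookup; tabulate)
open import Data.Vec.Properties using ([]=⇒lookup; lookup⇒[]=; lookup∘tabulate; tabulate-cong; map-∘; map-cong; map-id)
open import Data.Vec.Relation.Unary.All as All using (All; []; _∷_)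
import Data.Vec.Relation.Unary.All.Properties as Allₚ
open import Function using (_∘_)
open import Function.Bundles using (_⇔_; mk⇔)
open import Relation.Binary.Definitions using (tri<; tri≈; tri>)
open import Relation.Binary.PropositionalEquality using (_≡_; _≢_; refl; sym; trans; cong; cong₂; subst; subst₂; module ≡-Reasoning)
open import Relation.Nullary using (¬_; Dec; yes; no; does; contradiction)
open import Relation.Nullary.Decidable using (_×-dec_; _⊎-dec_; ¬?; dec-true; ¬¬-excluded-middle; decidable-stable; isYes)

-- Sums and linear forms over ℚ

infix 8 _·_

_·_ : ∀ {d} → (Fin d → ℚ) → (Fin d → ℚ) → ℚ
a · b = ∑ (λ t → a t * b t)

∑-cong : ∀ {k} {f g : Fin k → ℚ} → (∀ i → f i ≡ g i) → ∑ f ≡ ∑ g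
∑-cong {zero}  h = refl
∑-cong {suc k} h = cong₂ _+_ (h zero) (∑-cong (h ∘ suc))

∑-zero : ∀ {k} {f : Fin k → ℚ} → (∀ i → f i ≡ 0ℚ) → ∑ f ≡ 0ℚ
∑-zero {zero}  h = refl
∑-zero {suc k} h = trans (cong₂ _+_ (h zero) (∑-zero (h ∘ suc))) (ℚₚ.+-identityˡ 0ℚ)

∑-+ : ∀ {k} (f g : Fin k → ℚ) → ∑ (λ i → f i + g i) ≡ ∑ f + ∑ g
∑-+ {zero}  f g = refl
∑-+ {suc k} f g = trans (cong (f zero + g zero +_) (∑-+ (f ∘ suc) (g ∘ suc)))
  (ℚsolve 4 (λ a b c d → (a :+ b) :+ (c :+ d) := (a :+ c) :+ (b :+ d)) refl
    (f zero) (g zero) (∑ (f ∘ suc)) (∑ (g ∘ suc)))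

∑-* : ∀ {k} z (f : Fin k → ℚ) → ∑ (λ i → z * f i) ≡ z * ∑ f
∑-* {zero}  z f = sym (ℚₚ.*-zeroʳ z)
∑-* {suc k} z f = trans (cong (z * f zero +_) (∑-* z (f ∘ suc)))
  (sym (ℚₚ.*-distribˡ-+ z (f zero) (∑ (f ∘ suc))))

∑-swap : ∀ {k l} (f : Fin k → Fin l → ℚ) → ∑ (λ i → ∑ (f i)) ≡ ∑ (λ j → ∑ (λ i → f i j))
∑-swap {zero} {l} f = sym (∑-zero {l} (λ _ → refl))
∑-swap {suc k} f = trans (cong (∑ (f zero) +_) (∑-swap (f ∘ suc)))
  (sym (∑-+ (f zero) (λ j → ∑ (λ i → f (suc i) j))))

∑-single : ∀ {k} (p : Fin k) (f : Fin k → ℚ) → (∀ i → i ≢ p → f i ≡ 0ℚ) → ∑ f ≡ f p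
∑-single zero    f h = trans (cong (f zero +_) (∑-zero (λ i → h (suc i) λ ()))) (ℚₚ.+-identityʳ (f zero))
∑-single (suc p) f h = trans (cong₂ _+_ (h zero λ ())
  (∑-single p (f ∘ suc) (λ i i≢p → h (suc i) (i≢p ∘ suc-injective)))) (ℚₚ.+-identityˡ _)

∑-splitAt : ∀ k {l} (f : Fin (k +ₙ l) → ℚ) → ∑ f ≡ ∑ (λ i → f (i ↑ˡ l)) + ∑ (λ j → f (k ↑ʳ j))
∑-splitAt zero    f = sym (ℚₚ.+-identityˡ (∑ f))
∑-splitAt (suc k) f = trans (cong (f zero +_) (∑-splitAt k (f ∘ suc)))
  (sym (ℚₚ.+-assoc (f zero) _ _))

·-cong : ∀ {d} {a a' b b' : Fin d → ℚ} → (∀ t → a t ≡ a' t) → (∀ t → b t ≡ b' t) → a · b ≡ a' · b'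
·-cong h h' = ∑-cong (λ t → cong₂ _*_ (h t) (h' t))

·-comm : ∀ {d} (a b : Fin d → ℚ) → a · b ≡ b · a
·-comm a b = ∑-cong (λ t → ℚₚ.*-comm (a t) (b t))

·-+ˡ : ∀ {d} (a b c : Fin d → ℚ) → (λ t → a t + b t) · c ≡ a · c + b · c
·-+ˡ a b c = trans (∑-cong (λ t → ℚₚ.*-distribʳ-+ (c t) (a t) (b t))) (∑-+ (λ t → a t * c t) (λ t → b t * c t))

·-*ˡ : ∀ {d} z (a c : Fin d → ℚ) → (λ t → z * a t) · c ≡ z * (a · c)
·-*ˡ z a c = trans (∑-cong (λ t → ℚₚ.*-assoc z (a t) (c t))) (∑-* z (λ t → a t * c t))

·-negˡ : ∀ {d} (a c : Fin d → ℚ) → (λ t → - a t) · c ≡ - (a · c)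
·-negˡ a c = begin
  (λ t → - a t) · c            ≡⟨ ·-cong {b = c} (λ t → neg (a t)) (λ _ → refl) ⟩
  (λ t → (- 1ℚ) * a t) · c     ≡⟨ ·-*ˡ (- 1ℚ) a c ⟩
  (- 1ℚ) * (a · c)             ≡⟨ neg (a · c) ⟨
  - (a · c)                    ∎
  where
  open ≡-Reasoning
  neg : ∀ x → - x ≡ (- 1ℚ) * x
  neg x = trans (cong -_ (sym (ℚₚ.*-identityˡ x))) (ℚₚ.neg-distribˡ-* 1ℚ x)

unit-≡ : ∀ {d} (i : Fin d) → unit i i ≡ 1ℚ
unit-≡ i with i ≟ i
... | yes _ = refl
... | no ¬p = contradiction refl ¬p

unit-≢ : ∀ {d} {i t : Fin d} → i ≢ t → unit i t ≡ 0ℚ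
unit-≢ {i = i} {t} i≢t with i ≟ t
... | yes p = contradiction p i≢t
... | no _  = refl

unit-· : ∀ {d} (i : Fin d) (a : Fin d → ℚ) → unit i · a ≡ a i
unit-· i a = trans (∑-single i (λ t → unit i t * a t)
    (λ t t≢i → trans (cong (_* a t) (unit-≢ (t≢i ∘ sym))) (ℚₚ.*-zeroˡ (a t))))
  (trans (cong (_* a i) (unit-≡ i)) (ℚₚ.*-identityˡ (a i)))

inverse : ∀ {x} → x ≢ 0ℚ → ∃ λ y → y * x ≡ 1ℚ
inverse {x} x≢0 = (1/ x) {{≢-nonZero x≢0}} , ℚₚ.*-inverseˡ x {{≢-nonZero x≢0}}

*-nonzero : ∀ {x y} → x ≢ 0ℚ → x * y ≡ 0ℚ → y ≡ 0ℚ
*-nonzero {x} {y} x≢0 h with inverse x≢0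
... | z , zx≡1 = begin
  y             ≡⟨ ℚₚ.*-identityˡ y ⟨
  1ℚ * y        ≡⟨ cong (_* y) zx≡1 ⟨
  z * x * y     ≡⟨ ℚₚ.*-assoc z x y ⟩
  z * (x * y)   ≡⟨ cong (z *_) h ⟩
  z * 0ℚ        ≡⟨ ℚₚ.*-zeroʳ z ⟩
  0ℚ            ∎
  where open ≡-Reasoning

-- Cardinalities of subsets

x∉p-x : ∀ {n} (p : Subset n) x → x ∉ p - x
x∉p-x (true ∷ p)  zero ()
x∉p-x (false ∷ p) zero ()
x∉p-x (s ∷ p) (suc x) (there h) = x∉p-x p x h

∣p∣≡suc∣p-x∣ : ∀ {n} {p : Subset n} {x} → x ∈ p → ∣ p ∣ ≡ suc ∣ p - x ∣
∣p∣≡suc∣p-x∣ {p = true ∷ p} here = cong (suc ∘ ∣_∣) (sym (p─⊥≡p p))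
∣p∣≡suc∣p-x∣ {p = true ∷ p} (there h) = cong suc (∣p∣≡suc∣p-x∣ h)
∣p∣≡suc∣p-x∣ {p = false ∷ p} (there h) = ∣p∣≡suc∣p-x∣ h

p-x⊆p : ∀ {n} (p : Subset n) x → p - x ⊆ p
p-x⊆p p x = p─q⊆p p _

∈-≢ : ∀ {n} {p : Subset n} {x y} → y ∈ p - x → y ≢ x
∈-≢ {p = p} h refl = x∉p-x p _ h

Empty⇒∣p∣≡0 : ∀ {n} {p : Subset n} → (∀ x → x ∉ p) → ∣ p ∣ ≡ 0
Empty⇒∣p∣≡0 {n} {p} h = trans (cong ∣_∣ (Empty-unique (λ (x , x∈p) → h x x∈p))) (∣⊥∣≡0 n)

1≤∣p∣ : ∀ {n} {p : Subset n} {x} → x ∈ p → 1 ≤ ∣ p ∣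
1≤∣p∣ h = subst (1 ≤_) (sym (∣p∣≡suc∣p-x∣ h)) (s≤s z≤n)

2≤∣p∣ : ∀ {n} {p : Subset n} {x y} → x ∈ p → y ∈ p → y ≢ x → 2 ≤ ∣ p ∣
2≤∣p∣ hx hy y≢x = subst (2 ≤_) (sym (∣p∣≡suc∣p-x∣ hx)) (s≤s (1≤∣p∣ (x∈p∧x≢y⇒x∈p-y hy y≢x)))

3≤∣p∣ : ∀ {n} {p : Subset n} {x y z} → x ∈ p → y ∈ p → z ∈ p → y ≢ x → z ≢ x → z ≢ y → 3 ≤ ∣ p ∣
3≤∣p∣ hx hy hz y≢x z≢x z≢y = subst (3 ≤_) (sym (∣p∣≡suc∣p-x∣ hx))
  (s≤s (2≤∣p∣ (x∈p∧x≢y⇒x∈p-y hy y≢x) (x∈p∧x≢y⇒x∈p-y hz z≢x) z≢y))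

1≤∣p∣⇒Nonempty : ∀ {n} {p : Subset n} → 1 ≤ ∣ p ∣ → Nonempty p
1≤∣p∣⇒Nonempty {p = p} h with nonempty? p
... | yes q = q
... | no ¬q = contradiction (subst (1 ≤_) (Empty⇒∣p∣≡0 (λ x x∈p → ¬q (x , x∈p))) h) λ ()

2≤∣p∣⇒other : ∀ {n} {p : Subset n} → 2 ≤ ∣ p ∣ → ∀ {x} → x ∈ p → ∃ λ y → y ∈ p × y ≢ x
2≤∣p∣⇒other {p = p} h x∈p with 1≤∣p∣⇒Nonempty (ℕₚ.≤-pred (subst (2 ≤_) (∣p∣≡suc∣p-x∣ x∈p) h))
... | y , y∈ = y , p-x⊆p p _ y∈ , ∈-≢ {p = p} y∈

∣p∣≡1 : ∀ {n} {p : Subset n} {x} → x ∈ p → (∀ y → y ∈ p → y ≡ x) → ∣ p ∣ ≡ 1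
∣p∣≡1 {p = p} x∈p h = trans (∣p∣≡suc∣p-x∣ x∈p)
  (cong suc (Empty⇒∣p∣≡0 (λ y y∈ → ∈-≢ {p = p} y∈ (h y (p-x⊆p p _ y∈)))))

∣p∣≡2 : ∀ {n} {p : Subset n} {x y} → x ∈ p → y ∈ p → y ≢ x → (∀ z → z ∈ p → z ≡ x ⊎ z ≡ y) → ∣ p ∣ ≡ 2
∣p∣≡2 {p = p} {x} {y} x∈p y∈p y≢x h = trans (∣p∣≡suc∣p-x∣ x∈p)
  (cong suc (∣p∣≡1 (x∈p∧x≢y⇒x∈p-y y∈p y≢x) only))
  where
  only : ∀ z → z ∈ p - x → z ≡ y
  only z z∈ with h z (p-x⊆p p x z∈)
  ... | inj₁ z≡x = contradiction z≡x (∈-≢ {p = p} z∈)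
  ... | inj₂ z≡y = z≡y

elements : ∀ {n} (p : Subset n) → Vec (Fin n) ∣ p ∣
elements []          = []
elements (true ∷ p)  = zero ∷ map suc (elements p)
elements (false ∷ p) = map suc (elements p)

All-elements : ∀ {n} {P : Fin n → Set} (p : Subset n) → All P (elements p) → ∀ {x} → x ∈ p → P x
All-elements (true ∷ p)  (h ∷ hs) here      = h
All-elements (true ∷ p)  (h ∷ hs) (there i) = All-elements p (Allₚ.map⁻ hs) i
All-elements (false ∷ p) hs       (there i) = All-elements p (Allₚ.map⁻ hs) i

∣p∪q∣-disjoint : ∀ {n} (p q : Subset n) → (∀ {x} → x ∈ p → x ∉ q) → ∣ p ∪ q ∣ ≡ ∣ p ∣ +ₙ ∣ q ∣
∣p∪q∣-disjoint []          []          h = refl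
∣p∪q∣-disjoint (true ∷ p)  (true ∷ q)  h = contradiction here (h here)
∣p∪q∣-disjoint (true ∷ p)  (false ∷ q) h = cong suc (∣p∪q∣-disjoint p q (λ x y → h (there x) (there y)))
∣p∪q∣-disjoint (false ∷ p) (true ∷ q)  h = trans (cong suc (∣p∪q∣-disjoint p q (λ x y → h (there x) (there y))))
  (sym (ℕₚ.+-suc ∣ p ∣ ∣ q ∣))
∣p∪q∣-disjoint (false ∷ p) (false ∷ q) h = ∣p∪q∣-disjoint p q (λ x y → h (there x) (there y))

-- Gaussian elimination

-- Induction on the equations. One without a nonzero coefficient on `S` holds for every vector
-- supported there; otherwise it is solved for a pivot `p`, which leaves `S` and is substituted into
-- the remaining equations.
nontrivialSolution : ∀ {g l} (L : Vec (Fin g → ℚ) l) (S : Subset g) → l < ∣ S ∣ →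
  ∃ λ c → (∃ λ k → c k ≢ 0ℚ) × (∀ k → k ∉ S → c k ≡ 0ℚ) × All (λ e → c · e ≡ 0ℚ) L
nontrivialSolution [] S h with 1≤∣p∣⇒Nonempty h
... | k , k∈S = unit k
  , (k , λ e → contradiction (trans (sym (unit-≡ k)) e) λ ())
  , (λ i i∉S → unit-≢ (λ { refl → i∉S k∈S }))
  , []
nontrivialSolution (e ∷ L) S h with any? (λ k → (k ∈? S) ×-dec ¬? (e k ℚₚ.≟ 0ℚ))
... | no ¬pivot with nontrivialSolution L S (ℕₚ.<-trans (ℕₚ.n<1+n _) h)
...   | c , nz , supp , sol = c , nz , supp , ∑-zero vanish ∷ sol
  where
  vanish : ∀ k → c k * e k ≡ 0ℚ
  vanish k with k ∈? S | e k ℚₚ.≟ 0ℚ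
  ... | no k∉S  | _      = trans (cong (_* e k) (supp k k∉S)) (ℚₚ.*-zeroˡ (e k))
  ... | yes _   | yes z  = trans (cong (c k *_) z) (ℚₚ.*-zeroʳ (c k))
  ... | yes k∈S | no nz  = contradiction (k , k∈S , nz) ¬pivot
nontrivialSolution {g} (e ∷ L) S h | yes (p , p∈S , ep≢0) = c , (j , cj≢0) , supp , sol-e ∷ All.map sol-L (Allₚ.map⁻ sol')
  where
  open ≡-Reasoning
  w = proj₁ (inverse ep≢0)
  w*ep≡1 : w * e p ≡ 1ℚ
  w*ep≡1 = proj₂ (inverse ep≢0)

  eliminate : (Fin g → ℚ) → Fin g → ℚ
  eliminate f k = f k + (- (f p * w)) * e k

  reduced = nontrivialSolution (map eliminate L) (S - p)
    (ℕₚ.≤-pred (subst (suc _ <_) (∣p∣≡suc∣p-x∣ p∈S) h))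
  c' = proj₁ reduced
  j = proj₁ (proj₁ (proj₂ reduced))
  c'j≢0 = proj₂ (proj₁ (proj₂ reduced))
  supp' = proj₁ (proj₂ (proj₂ reduced))
  sol' = proj₂ (proj₂ (proj₂ reduced))

  -- `c'` vanishes at the pivot, so the value there is free; this choice solves `e`.
  z : ℚ
  z = - ((c' · e) * w)

  c : Fin g → ℚ
  c k = c' k + z * unit p k

  c·_ : ∀ f → c · f ≡ c' · f + z * f p
  c· f = begin
    c · f                              ≡⟨ ·-+ˡ c' (λ k → z * unit p k) f ⟩
    c' · f + (λ k → z * unit p k) · f  ≡⟨ cong (c' · f +_) (·-*ˡ z (unit p) f) ⟩
    c' · f + z * (unit p · f)          ≡⟨ cong (λ y → c' · f + z * y) (unit-· p f) ⟩
    c' · f + z * f p                   ∎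

  c-≢ : ∀ {k} → p ≢ k → c k ≡ c' k
  c-≢ {k} p≢k = begin
    c' k + z * unit p k  ≡⟨ cong (λ y → c' k + z * y) (unit-≢ p≢k) ⟩
    c' k + z * 0ℚ        ≡⟨ ℚsolve 2 (λ x y → x :+ y :* con 0ℚ := x) refl (c' k) z ⟩
    c' k                 ∎

  p≢j : p ≢ j
  p≢j p≡j = c'j≢0 (subst (λ k → c' k ≡ 0ℚ) p≡j (supp' p (x∉p-x S p)))

  cj≢0 : c j ≢ 0ℚ
  cj≢0 cj≡0 = c'j≢0 (trans (sym (c-≢ p≢j)) cj≡0)

  supp : ∀ k → k ∉ S → c k ≡ 0ℚ
  supp k k∉S = trans (c-≢ (λ { refl → k∉S p∈S })) (supp' k (k∉S ∘ p-x⊆p S p))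

  sol-e : c · e ≡ 0ℚ
  sol-e = begin
    c · e                                ≡⟨ c· e ⟩
    c' · e + (- ((c' · e) * w)) * e p    ≡⟨ ℚsolve 3 (λ d w x → d :+ (:- (d :* w)) :* x := d :+ (:- (d :* (w :* x)))) refl (c' · e) w (e p) ⟩
    c' · e + (- ((c' · e) * (w * e p)))  ≡⟨ cong (λ y → c' · e + (- ((c' · e) * y))) w*ep≡1 ⟩
    c' · e + (- ((c' · e) * 1ℚ))         ≡⟨ ℚsolve 1 (λ d → d :+ (:- (d :* con 1ℚ)) := con 0ℚ) refl (c' · e) ⟩
    0ℚ                                   ∎

  sol-L : ∀ {f} → c' · eliminate f ≡ 0ℚ → c · f ≡ 0ℚ
  sol-L {f} hf = begin
    c · f                                        ≡⟨ c· f ⟩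
    c' · f + (- ((c' · e) * w)) * f p            ≡⟨ ℚsolve 4 (λ x d w y → x :+ (:- (d :* w)) :* y := x :+ (:- (y :* w)) :* d) refl (c' · f) (c' · e) w (f p) ⟩
    c' · f + (- (f p * w)) * (c' · e)            ≡⟨ cong₂ _+_ (·-comm f c') (trans (·-*ˡ (- (f p * w)) e c') (cong ((- (f p * w)) *_) (·-comm e c'))) ⟨
    f · c' + (λ k → (- (f p * w)) * e k) · c'    ≡⟨ ·-+ˡ f (λ k → (- (f p * w)) * e k) c' ⟨
    eliminate f · c'                             ≡⟨ ·-comm (eliminate f) c' ⟩
    c' · eliminate f                             ≡⟨ hf ⟩
    0ℚ                                           ∎

indicator : ∀ {g} → Subset g → Fin g → ℚ
indicator A k = if lookup A k then 1ℚ else 0ℚ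

indicator-∈ : ∀ {g} {A : Subset g} {k} → k ∈ A → indicator A k ≡ 1ℚ
indicator-∈ h rewrite []=⇒lookup h = refl

indicator-∉ : ∀ {g} {A : Subset g} {k} → k ∉ A → indicator A k ≡ 0ℚ
indicator-∉ {A = A} {k} h with lookup A k in eq
... | true  = contradiction (lookup⇒[]= k A eq) h
... | false = refl

∣⊤++p∣ : ∀ k {n} (p : Subset n) → ∣ ⊤ {k} ++ p ∣ ≡ k +ₙ ∣ p ∣
∣⊤++p∣ zero    p = refl
∣⊤++p∣ (suc k) p = cong suc (∣⊤++p∣ k p)

↑ʳ-∈⁻ : ∀ k {n} {q : Subset k} {p : Subset n} {x} → (k ↑ʳ x) ∈ q ++ p → x ∈ p
↑ʳ-∈⁻ zero    {q = []}    h         = h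
↑ʳ-∈⁻ (suc k) {q = _ ∷ q} (there h) = ↑ʳ-∈⁻ k h

·-splitAt : ∀ k {d} (c : Fin (k +ₙ d) → ℚ) (a : Fin k → ℚ) (b : Fin d → ℚ) →
  c · ([ a , b ]′ ∘ splitAt k) ≡ (λ i → c (i ↑ˡ d)) · a + (λ t → c (k ↑ʳ t)) · b
·-splitAt k {d} c a b = trans (∑-splitAt k _) (cong₂ _+_
  (∑-cong (λ i → cong (λ s → c (i ↑ˡ d) * [ a , b ]′ s) (splitAt-↑ˡ k i d)))
  (∑-cong (λ t → cong (λ s → c (k ↑ʳ t) * [ a , b ]′ s) (splitAt-↑ʳ k d t))))

-- Functionals, ranks and spans of a vector configuration

module Vectors {g d : ℕ} (v : Fin g → Fin d → ℚ) where

  Kills : (Fin d → ℚ) → Subset g → Set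
  Kills φ X = ∀ k → k ∈ X → φ · v k ≡ 0ℚ

  combination : (Fin g → ℚ) → Fin d → ℚ
  combination c t = ∑ (λ k → c k * v k t)

  ·-combination : ∀ φ c → φ · combination c ≡ c · (λ k → φ · v k)
  ·-combination φ c = begin
    ∑ (λ t → φ t * ∑ (λ k → c k * v k t))    ≡⟨ ∑-cong (λ t → ∑-* (φ t) (λ k → c k * v k t)) ⟨
    ∑ (λ t → ∑ (λ k → φ t * (c k * v k t)))  ≡⟨ ∑-swap (λ t k → φ t * (c k * v k t)) ⟩
    ∑ (λ k → ∑ (λ t → φ t * (c k * v k t)))  ≡⟨ ∑-cong (λ k → ∑-cong (λ t → ℚsolve 3 (λ x y z → x :* (y :* z) := y :* (x :* z)) refl (φ t) (c k) (v k t))) ⟩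
    ∑ (λ k → ∑ (λ t → c k * (φ t * v k t)))  ≡⟨ ∑-cong (λ k → ∑-* (c k) (λ t → φ t * v k t)) ⟩
    ∑ (λ k → c k * (φ · v k))                ∎
    where open ≡-Reasoning

  ·-vanish : ∀ φ c → (∀ t → combination c t ≡ 0ℚ) → c · (λ k → φ · v k) ≡ 0ℚ
  ·-vanish φ c h = trans (sym (·-combination φ c)) (∑-zero (λ t → trans (cong (φ t *_) (h t)) (ℚₚ.*-zeroʳ (φ t))))

  -- If φ killed `A` but not `v x`, applying φ to a relation on `A ∪ ⁅ x ⁆` would force the
  -- coefficient of `x` to vanish; that set would then be independent, against maximality. Hence as
  -- many equations as the rank suffice to kill all of `X`.
  kills-basis : ∀ {X A} → LinIndep v A → (∀ Y → Y ⊆ X → LinIndep v Y → ∣ Y ∣ ≤ ∣ A ∣) → A ⊆ X →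
    ∀ φ → Kills φ A → Kills φ X
  kills-basis {X} {A} indA max A⊆X φ killsA x x∈X with φ · v x ℚₚ.≟ 0ℚ | x ∈? A
  ... | yes h | _       = h
  ... | no _  | yes x∈A = killsA x x∈A
  ... | no nz | no x∉A  = contradiction (max (A ∪ ⁅ x ⁆) A∪x⊆X indA∪x) (ℕₚ.<⇒≱ (subst (∣ A ∣ <_) (sym size) (ℕₚ.n<1+n _)))
    where
    size : ∣ A ∪ ⁅ x ⁆ ∣ ≡ suc ∣ A ∣
    size = trans (∣p∪q∣-disjoint A ⁅ x ⁆ (λ y∈A y∈x → x∉A (subst (_∈ A) (x∈⁅y⁆⇒x≡y x y∈x) y∈A)))
      (trans (cong (∣ A ∣ +ₙ_) (∣⁅x⁆∣≡1 x)) (ℕₚ.+-comm ∣ A ∣ 1))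

    A∪x⊆X : A ∪ ⁅ x ⁆ ⊆ X
    A∪x⊆X y∈ with x∈p∪q⁻ A ⁅ x ⁆ y∈
    ... | inj₁ y∈A = A⊆X y∈A
    ... | inj₂ y∈x = subst (_∈ X) (sym (x∈⁅y⁆⇒x≡y x y∈x)) x∈X

    indA∪x : LinIndep v (A ∪ ⁅ x ⁆)
    indA∪x c supp h = indA c supp' h
      where
      only-x : ∀ k → k ≢ x → c k * (φ · v k) ≡ 0ℚ
      only-x k k≢x with k ∈? A
      ... | yes k∈A = trans (cong (c k *_) (killsA k k∈A)) (ℚₚ.*-zeroʳ (c k))
      ... | no k∉A  = trans (cong (_* (φ · v k)) (supp k k∉)) (ℚₚ.*-zeroˡ (φ · v k))
        where
        k∉ : k ∉ A ∪ ⁅ x ⁆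
        k∉ k∈ with x∈p∪q⁻ A ⁅ x ⁆ k∈
        ... | inj₁ k∈A = k∉A k∈A
        ... | inj₂ k∈x = k≢x (x∈⁅y⁆⇒x≡y x k∈x)

      cx≡0 : c x ≡ 0ℚ
      cx≡0 = *-nonzero nz (trans (ℚₚ.*-comm (φ · v x) (c x)) (trans (sym (∑-single x _ only-x)) (·-vanish φ c h)))

      supp' : ∀ k → k ∉ A → c k ≡ 0ℚ
      supp' k k∉A with k ≟ x
      ... | yes refl = cx≡0
      ... | no k≢x   = supp k (λ k∈ → [ k∉A , (λ k∈x → k≢x (x∈⁅y⁆⇒x≡y x k∈x)) ]′ (x∈p∪q⁻ A ⁅ x ⁆ k∈))

  -- Independence quantifies over all rational coefficients and is not decided here, so a maximal
  -- independent set is found only under double negation, which is enough for a negated goal. The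
  -- fuel bounds the number of enlargements, since a subset has at most `g` elements.
  ¬¬-rank : ∀ X → ¬ ¬ ∃ (IsRank (LinIndep v) X)
  ¬¬-rank X = search (suc g) ⊥ (λ h → ⊥-elim (∉⊥ h)) (λ c supp _ k → supp k ∉⊥) (subst (λ r → g < r +ₙ suc g) (sym (∣⊥∣≡0 g)) (ℕₚ.n<1+n g))
    where
    search : ∀ fuel Y → Y ⊆ X → LinIndep v Y → g < ∣ Y ∣ +ₙ fuel → ¬ ¬ ∃ (IsRank (LinIndep v) X)
    search zero Y Y⊆X indY lt _ = ℕₚ.<⇒≱ (subst (g <_) (ℕₚ.+-identityʳ ∣ Y ∣) lt) (∣p∣≤n Y)
    search (suc fuel) Y Y⊆X indY lt none = ¬¬-excluded-middle {A = ∃ λ Z → Z ⊆ X × LinIndep v Z × ∣ Y ∣ < ∣ Z ∣} λ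
      { (yes (Z , Z⊆X , indZ , Y<Z)) → search fuel Z Z⊆X indZ
          (ℕₚ.<-≤-trans (subst (g <_) (ℕₚ.+-suc ∣ Y ∣ fuel) lt) (ℕₚ.+-monoˡ-≤ fuel Y<Z)) none
      ; (no noLarger) → none (∣ Y ∣ , (Y , Y⊆X , indY , refl)
          , λ Z Z⊆X indZ → ℕₚ.≮⇒≥ (λ Y<Z → noLarger (Z , Z⊆X , indZ , Y<Z))) }

  -- The vectors live in the coordinates `D`; `spanning` says in dual form that they span this
  -- space, so their rank is the size of `D`.
  module Spanning (D : Subset d) (v-supp : ∀ k t → t ∉ D → v k t ≡ 0ℚ)
    (spanning : ∀ φ → (∀ t → t ∉ D → φ t ≡ 0ℚ) → (∀ k → φ · v k ≡ 0ℚ) → ∀ t → φ t ≡ 0ℚ) where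

    coordinates : Vec (Fin g → ℚ) ∣ D ∣
    coordinates = map (λ t k → v k t) (elements D)

    combination-zero : ∀ c → All (λ e → c · e ≡ 0ℚ) coordinates → ∀ t → combination c t ≡ 0ℚ
    combination-zero c h t with t ∈? D
    ... | yes t∈D = All-elements D (Allₚ.map⁻ h) t∈D
    ... | no t∉D  = ∑-zero (λ k → trans (cong (c k *_) (v-supp k t t∉D)) (ℚₚ.*-zeroʳ (c k)))

    rank≤ : ∀ {c} → IsRank (LinIndep v) ⊤ c → c ≤ ∣ D ∣
    rank≤ ((C , _ , indC , refl) , _) = ℕₚ.≮⇒≥ λ lt →
      let (c , (k , ck≢0) , supp , sol) = nontrivialSolution coordinates C lt
      in ck≢0 (indC c supp (combination-zero c sol) k)

    -- With fewer basis vectors than coordinates, some nonzero functional on `D` kills the basis,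
    -- hence all the vectors, against `spanning`.
    rank≥ : ∀ {c} → IsRank (LinIndep v) ⊤ c → ∣ D ∣ ≤ c
    rank≥ ((C , C⊆ , indC , refl) , max) = ℕₚ.≮⇒≥ λ lt →
      let (φ , (t , φt≢0) , supp , sol) = nontrivialSolution (map v (elements C)) D lt
      in φt≢0 (spanning φ supp (λ k → kills-basis indC max C⊆ φ (λ j j∈C → All-elements C (Allₚ.map⁻ sol) j∈C) k ∈⊤) t)

    -- Counting unknowns: the functionals on D and the coefficients α number |D| + k, the equations
    -- a + b < |D| + k.
    decompose : ∀ {k X} → MatroidSeparation (LinIndep v) k X → (f : Fin k → Fin d → ℚ) →
      Σ (Fin d → ℚ) λ φ → Σ (Fin d → ℚ) λ ψ → Σ (Fin k → ℚ) λ α →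
        Kills φ X × Kills ψ (∁ X) × (∀ t → φ t + ψ t ≡ ∑ (λ i → α i * f i t)) × ∃ λ i → α i ≢ 0ℚ
    decompose {k} {X} (_ , _ , _ , _ , c , ((A , A⊆X , indA , refl) , maxA) , ((B , B⊆Y , indB , refl) , maxB) , rankM , lt) f
      = φ , ψ , α , killsX , killsY , sum , α≢0
      where
      open ≡-Reasoning

      -- The unknowns are α (the first `k` places) and φ; ψ is eliminated as F - φ. The rows `eqX`
      -- say that φ kills the basis of `X`, the rows `eqY` that ψ kills the basis of `∁ X`.
      eqX : Fin g → Fin (k +ₙ d) → ℚ
      eqX x = [ (λ _ → 0ℚ) , v x ]′ ∘ splitAt k

      eqY : Fin g → Fin (k +ₙ d) → ℚ
      eqY y = [ (λ i → f i · v y) , (λ t → - v y t) ]′ ∘ splitAt k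

      solution = nontrivialSolution (map eqX (elements A) ++ map eqY (elements B)) (⊤ {k} ++ D)
        (ℕₚ.<-≤-trans lt (ℕₚ.≤-trans (ℕₚ.+-monoˡ-≤ k (rank≤ rankM))
          (ℕₚ.≤-reflexive (trans (ℕₚ.+-comm ∣ D ∣ k) (sym (∣⊤++p∣ k D))))))

      s = proj₁ solution
      i₀ = proj₁ (proj₁ (proj₂ solution))
      si₀≢0 = proj₂ (proj₁ (proj₂ solution))
      supp = proj₁ (proj₂ (proj₂ solution))
      sols = Allₚ.++⁻ (map eqX (elements A)) (proj₂ (proj₂ (proj₂ solution)))

      α : Fin k → ℚ
      α i = s (i ↑ˡ d)

      φ : Fin d → ℚ
      φ t = s (k ↑ʳ t)

      F : Fin d → ℚ
      F t = ∑ (λ i → α i * f i t)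

      ψ : Fin d → ℚ
      ψ t = F t + (- φ t)

      sum : ∀ t → φ t + ψ t ≡ F t
      sum t = ℚsolve 2 (λ x y → x :+ (y :+ (:- x)) := y) refl (φ t) (F t)

      killsA : Kills φ A
      killsA x x∈A = begin
        φ · v x                         ≡⟨ ℚₚ.+-identityˡ _ ⟨
        0ℚ + φ · v x                    ≡⟨ cong (_+ φ · v x) (∑-zero (λ i → ℚₚ.*-zeroʳ (α i))) ⟨
        α · (λ _ → 0ℚ) + φ · v x        ≡⟨ ·-splitAt k s (λ _ → 0ℚ) (v x) ⟨
        s · eqX x                       ≡⟨ All-elements A (Allₚ.map⁻ (proj₁ sols)) x∈A ⟩
        0ℚ                              ∎

      F· : ∀ w → F · w ≡ α · (λ i → f i · w)
      F· w = begin
        ∑ (λ t → ∑ (λ i → α i * f i t) * w t)    ≡⟨ ∑-cong (λ t → trans (ℚₚ.*-comm (F t) (w t)) (sym (∑-* (w t) (λ i → α i * f i t)))) ⟩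
        ∑ (λ t → ∑ (λ i → w t * (α i * f i t)))  ≡⟨ ∑-swap (λ t i → w t * (α i * f i t)) ⟩
        ∑ (λ i → ∑ (λ t → w t * (α i * f i t)))  ≡⟨ ∑-cong (λ i → ∑-cong (λ t → ℚsolve 3 (λ x y z → x :* (y :* z) := y :* (z :* x)) refl (w t) (α i) (f i t))) ⟩
        ∑ (λ i → ∑ (λ t → α i * (f i t * w t)))  ≡⟨ ∑-cong (λ i → ∑-* (α i) (λ t → f i t * w t)) ⟩
        ∑ (λ i → α i * (f i · w))                ∎

      killsB : Kills ψ B
      killsB y y∈B = begin
        ψ · v y                                        ≡⟨ ·-+ˡ F (λ t → - φ t) (v y) ⟩
        F · v y + (λ t → - φ t) · v y                  ≡⟨ cong (_+ (λ t → - φ t) · v y) (F· (v y)) ⟩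
        α · (λ i → f i · v y) + (λ t → - φ t) · v y    ≡⟨ cong (α · (λ i → f i · v y) +_) (∑-cong (λ t → trans (sym (ℚₚ.neg-distribˡ-* (φ t) (v y t))) (ℚₚ.neg-distribʳ-* (φ t) (v y t)))) ⟩
        α · (λ i → f i · v y) + φ · (λ t → - v y t)    ≡⟨ ·-splitAt k s _ _ ⟨
        s · eqY y                                      ≡⟨ All-elements B (Allₚ.map⁻ (proj₂ sols)) y∈B ⟩
        0ℚ                                             ∎

      killsX : Kills φ X
      killsX = kills-basis indA maxA A⊆X φ killsA

      killsY : Kills ψ (∁ X)
      killsY = kills-basis indB maxB B⊆Y ψ killsB

      φ-supp : ∀ t → t ∉ D → φ t ≡ 0ℚ
      φ-supp t t∉D = supp (k ↑ʳ t) (t∉D ∘ ↑ʳ-∈⁻ k {q = ⊤})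

      -- If α vanishes, then ψ = -φ, so φ kills both sides and is zero by `spanning`. A nonzero
      -- solution therefore has a nonzero α.
      φ≡0 : (∀ i → α i ≡ 0ℚ) → ∀ t → φ t ≡ 0ℚ
      φ≡0 α≡0 = spanning φ φ-supp kills
        where
        ψ≡-φ : ∀ t → ψ t ≡ - φ t
        ψ≡-φ t = trans (cong (_+ (- φ t)) (∑-zero (λ i → trans (cong (_* f i t) (α≡0 i)) (ℚₚ.*-zeroˡ (f i t))))) (ℚₚ.+-identityˡ (- φ t))

        kills : ∀ x → φ · v x ≡ 0ℚ
        kills x with x ∈? X
        ... | yes x∈X = killsX x x∈X
        ... | no x∉X  = ℚₚ.neg-injective (begin
          - (φ · v x)            ≡⟨ ·-negˡ φ (v x) ⟨
          (λ t → - φ t) · v x    ≡⟨ ·-cong {b = v x} ψ≡-φ (λ _ → refl) ⟨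
          ψ · v x                ≡⟨ killsY x (x∉p⇒x∈∁p x∉X) ⟩
          0ℚ                     ∎)

      s≡0 : (∀ i → α i ≡ 0ℚ) → ∀ i → s i ≡ 0ℚ
      s≡0 α≡0 i with splitAt k i in eq
      ... | inj₁ j = subst (λ x → s x ≡ 0ℚ) (splitAt⁻¹-↑ˡ eq) (α≡0 j)
      ... | inj₂ t = subst (λ x → s x ≡ 0ℚ) (splitAt⁻¹-↑ʳ eq) (φ≡0 α≡0 t)

      α≢0 : ∃ λ i → α i ≢ 0ℚ
      α≢0 with any? (λ i → ¬? (α i ℚₚ.≟ 0ℚ))
      ... | yes h = h
      ... | no ¬h = contradiction (s≡0 (λ i → decidable-stable (α i ℚₚ.≟ 0ℚ) (λ nz → ¬h (i , nz))) i₀) si₀≢0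

    -- The vectors p are the elements of span X ∩ span (∁ X), whose dimension is r(X) + r(∁ X) − r(M).
    span-intersection : ∀ {j X} → suc j < 3 → suc j ≤ ∣ X ∣ → suc j ≤ ∣ ∁ X ∣ → (ℓs : Vec (Fin d → ℚ) j) →
      (∀ p → (∀ φ → Kills φ X → φ · p ≡ 0ℚ) → (∀ ψ → Kills ψ (∁ X) → ψ · p ≡ 0ℚ) →
        All (λ ℓ → ℓ · p ≡ 0ℚ) ℓs → ∀ t → p t ≡ 0ℚ) →
      ¬ Matroid3Connected (LinIndep v)
    span-intersection {j} {X} j<2 j<X j<Y ℓs trivial connected =
      ¬¬-rank X λ (a , rankX) → ¬¬-rank (∁ X) λ (b , rankY) → ¬¬-rank ⊤ λ (c , rankM) →
        connected (suc j) X (s≤s z≤n) j<2 (j<X , j<Y , a , b , c , rankX , rankY , rankM ,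
          ℕₚ.≰⇒> (tooLarge rankX rankY rankM))
      where
      open ≡-Reasoning
      tooLarge : ∀ {a b c} → IsRank (LinIndep v) X a → IsRank (LinIndep v) (∁ X) b → IsRank (LinIndep v) ⊤ c →
        ¬ (c +ₙ suc j ≤ a +ₙ b)
      tooLarge {c = c'} ((A , A⊆X , indA , refl) , _) ((B , B⊆Y , indB , refl) , _) rankM large = ck≢0 (c≡0 k₀)
        where
        disjoint : ∀ {x} → x ∈ A → x ∉ B
        disjoint x∈A x∈B = x∈p⇒x∉∁p (A⊆X x∈A) (B⊆Y x∈B)

        eqℓ : (Fin d → ℚ) → Fin g → ℚ
        eqℓ ℓ k = indicator A k * (ℓ · v k)

        -- A relation between the bases `A` and `B` whose `A`-part is annihilated by every ℓ. The
        -- equations number ∣ D ∣ + j, the unknowns at least c + j + 1.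
        solution = nontrivialSolution (coordinates ++ map eqℓ ℓs) (A ∪ B)
          (subst (∣ D ∣ +ₙ j <_) (sym (∣p∪q∣-disjoint A B disjoint))
            (ℕₚ.≤-trans (ℕₚ.≤-reflexive (sym (ℕₚ.+-suc ∣ D ∣ j)))
              (ℕₚ.≤-trans (ℕₚ.+-monoˡ-≤ (suc j) (rank≥ rankM)) large)))

        c = proj₁ solution
        k₀ = proj₁ (proj₁ (proj₂ solution))
        ck≢0 = proj₂ (proj₁ (proj₂ solution))
        supp = proj₁ (proj₂ (proj₂ solution))
        sols = Allₚ.++⁻ coordinates (proj₂ (proj₂ (proj₂ solution)))

        cA cB : Fin g → ℚ
        cA k = c k * indicator A k
        cB k = c k + (- cA k)

        cA+cB : ∀ k → c k ≡ cA k + cB k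
        cA+cB k = ℚsolve 2 (λ x y → x := y :+ (x :+ (:- y))) refl (c k) (cA k)

        comb-c : ∀ t → combination c t ≡ 0ℚ
        comb-c = combination-zero c (proj₁ sols)

        cA-supp : ∀ k → k ∉ A → cA k ≡ 0ℚ
        cA-supp k k∉A = trans (cong (c k *_) (indicator-∉ k∉A)) (ℚₚ.*-zeroʳ (c k))

        cB-supp : ∀ k → k ∉ B → cB k ≡ 0ℚ
        cB-supp k k∉B with k ∈? A
        ... | yes k∈A = trans (cong (λ y → c k + (- (c k * y))) (indicator-∈ k∈A))
          (ℚsolve 1 (λ x → x :+ (:- (x :* con 1ℚ)) := con 0ℚ) refl (c k))
        ... | no k∉A  = trans (cong (λ x → x + (- (x * indicator A k))) (supp k (λ k∈ → [ k∉A , k∉B ]′ (x∈p∪q⁻ A B k∈))))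
          (ℚsolve 1 (λ y → con 0ℚ :+ (:- (con 0ℚ :* y)) := con 0ℚ) refl (indicator A k))

        -- The `A`-part of the relation is minus its `B`-part, so it lies in both spans.
        p : Fin d → ℚ
        p = combination cA

        supported : ∀ {Z : Subset g} e φ → (∀ k → k ∉ Z → e k ≡ 0ℚ) → Kills φ Z → e · (λ k → φ · v k) ≡ 0ℚ
        supported {Z} e φ h kills = ∑-zero term
          where
          term : ∀ k → e k * (φ · v k) ≡ 0ℚ
          term k with k ∈? Z
          ... | yes k∈Z = trans (cong (e k *_) (kills k k∈Z)) (ℚₚ.*-zeroʳ (e k))
          ... | no k∉Z  = trans (cong (_* (φ · v k)) (h k k∉Z)) (ℚₚ.*-zeroˡ (φ · v k))

        φ·p : ∀ φ → Kills φ X → φ · p ≡ 0ℚ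
        φ·p φ kills = trans (·-combination φ cA) (supported cA φ cA-supp (λ k k∈A → kills k (A⊆X k∈A)))

        ψ·p : ∀ ψ → Kills ψ (∁ X) → ψ · p ≡ 0ℚ
        ψ·p ψ kills = begin
          ψ · p               ≡⟨ ·-combination ψ cA ⟩
          cA · w              ≡⟨ ℚₚ.+-identityʳ _ ⟨
          cA · w + 0ℚ         ≡⟨ cong (cA · w +_) (supported cB ψ cB-supp (λ k k∈B → kills k (B⊆Y k∈B))) ⟨
          cA · w + cB · w     ≡⟨ ·-+ˡ cA cB w ⟨
          (λ k → cA k + cB k) · w  ≡⟨ ·-cong {b = w} cA+cB (λ _ → refl) ⟨
          c · w               ≡⟨ ·-vanish ψ c comb-c ⟩
          0ℚ                  ∎
          where
          w : Fin g → ℚ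
          w k = ψ · v k

        ℓ·p : ∀ ℓ → c · eqℓ ℓ ≡ 0ℚ → ℓ · p ≡ 0ℚ
        ℓ·p ℓ h = begin
          ℓ · p                  ≡⟨ ·-combination ℓ cA ⟩
          cA · (λ k → ℓ · v k)   ≡⟨ ∑-cong (λ k → ℚₚ.*-assoc (c k) (indicator A k) (ℓ · v k)) ⟩
          c · eqℓ ℓ              ≡⟨ h ⟩
          0ℚ                     ∎

        -- `trivial` makes the `A`-part zero; independence of `A`, and then of `B`, kills the whole
        -- relation.
        cA≡0 : ∀ k → cA k ≡ 0ℚ
        cA≡0 = indA cA cA-supp (trivial p φ·p ψ·p (All.map (λ {ℓ} → ℓ·p ℓ) (Allₚ.map⁻ (proj₂ sols))))

        c≡cB : ∀ k → cB k ≡ c k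
        c≡cB k = trans (cong (λ y → c k + (- y)) (cA≡0 k)) (ℚₚ.+-identityʳ (c k))

        c≡0 : ∀ k → c k ≡ 0ℚ
        c≡0 k = trans (sym (c≡cB k))
          (indB cB cB-supp (λ t → trans (∑-cong (λ i → cong (_* v i t) (c≡cB i))) (comb-c t)) k)

-- Separations and walks of graphs

comprehension : ∀ {n} {P : Fin n → Set} → (∀ x → Dec (P x)) → Subset n
comprehension P? = tabulate (λ x → does (P? x))

∈-comprehension⁺ : ∀ {n} {P : Fin n → Set} (P? : ∀ x → Dec (P x)) {x} → P x → x ∈ comprehension P?
∈-comprehension⁺ P? {x} Px = lookup⇒[]= x _ (trans (lookup∘tabulate (λ x → does (P? x)) x) (dec-true (P? x) Px))

∈-comprehension⁻ : ∀ {n} {P : Fin n → Set} (P? : ∀ x → Dec (P x)) {x} → x ∈ comprehension P? → P x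
∈-comprehension⁻ P? {x} x∈ with P? x | trans (sym (lookup∘tabulate (λ x → does (P? x)) x)) ([]=⇒lookup x∈)
... | yes Px | _ = Px

∁-involutive : ∀ {n} (p : Subset n) → ∁ (∁ p) ≡ p
∁-involutive p = trans (sym (map-∘ not not p)) (trans (map-cong not-involutive p) (map-id p))

anyFin⁺ : ∀ {k} (f : Fin k → Bool) i → f i ≡ true → anyFin f ≡ true
anyFin⁺ f zero    h rewrite h = refl
anyFin⁺ f (suc i) h with f zero
... | true  = refl
... | false = anyFin⁺ (f ∘ suc) i h

anyFin⁻ : ∀ {k} (f : Fin k → Bool) → anyFin f ≡ true → ∃ λ i → f i ≡ true
anyFin⁻ {suc k} f h with f zero in eq
... | true  = zero , eq
... | false with anyFin⁻ (f ∘ suc) h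
...   | i , fi = suc i , fi

∧⁺ : ∀ {a b} → a ≡ true → b ≡ true → a ∧ b ≡ true
∧⁺ refl refl = refl

∧⁻ : ∀ {a b} → a ∧ b ≡ true → a ≡ true × b ≡ true
∧⁻ {true} h = refl , h

module GraphLemmas (G : Graph) where

  V E : Set
  V = Fin (n G)
  E = Fin (m G)

  Incident : E → V → Set
  Incident e x = src G e ≡ x ⊎ tgt G e ≡ x

  incident? : ∀ e x → Dec (Incident e x)
  incident? e x = (src G e ≟ x) ⊎-dec (tgt G e ≟ x)

  Joins : E → V → V → Set
  Joins e x y = (src G e ≡ x × tgt G e ≡ y) ⊎ (src G e ≡ y × tgt G e ≡ x)

  joins-incidentˡ : ∀ {e x y} → Joins e x y → Incident e x
  joins-incidentˡ = [ inj₁ ∘ proj₁ , inj₂ ∘ proj₂ ]′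

  joins-incidentʳ : ∀ {e x y} → Joins e x y → Incident e y
  joins-incidentʳ = [ inj₂ ∘ proj₂ , inj₁ ∘ proj₁ ]′

  joins-ends : ∀ {e x y z} → Joins e x y → Incident e z → z ≡ x ⊎ z ≡ y
  joins-ends (inj₁ (p , q)) (inj₁ r) = inj₁ (trans (sym r) p)
  joins-ends (inj₁ (p , q)) (inj₂ r) = inj₂ (trans (sym r) q)
  joins-ends (inj₂ (p , q)) (inj₁ r) = inj₂ (trans (sym r) p)
  joins-ends (inj₂ (p , q)) (inj₂ r) = inj₁ (trans (sym r) q)

  otherEnd : ∀ {e x} → Incident e x → ∃ (Joins e x)
  otherEnd {e} (inj₁ p) = tgt G e , inj₁ (p , refl)
  otherEnd {e} (inj₂ p) = src G e , inj₂ (refl , p)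

  joins-const : ∀ {A : Set} (Φ : V → A) {e x y} → Φ (src G e) ≡ Φ (tgt G e) → Joins e x y → Φ x ≡ Φ y
  joins-const Φ h (inj₁ (refl , refl)) = h
  joins-const Φ h (inj₂ (refl , refl)) = sym h

  incident⁺ : ∀ {e x} → Incident e x → incident G e x ≡ true
  incident⁺ {e} {x} h with src G e ≟ x | tgt G e ≟ x | h
  ... | yes _ | _     | _      = refl
  ... | no _  | yes _ | _      = refl
  ... | no ¬p | no _  | inj₁ p = contradiction p ¬p
  ... | no _  | no ¬q | inj₂ q = contradiction q ¬q

  incident⁻ : ∀ {e x} → incident G e x ≡ true → Incident e x
  incident⁻ {e} {x} h with src G e ≟ x | tgt G e ≟ x
  ... | yes p | _     = inj₁ p
  ... | no _  | yes q = inj₂ q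

  ∈-verts⁺ : ∀ {X e x} → e ∈ X → Incident e x → lookup (verts G X) x ≡ true
  ∈-verts⁺ {X} {e} {x} e∈X inc = trans (lookup∘tabulate _ x)
    (anyFin⁺ (λ e → lookup X e ∧ incident G e x) e (∧⁺ ([]=⇒lookup e∈X) (incident⁺ inc)))

  ∈-verts⁻ : ∀ {X x} → lookup (verts G X) x ≡ true → ∃ λ e → e ∈ X × Incident e x
  ∈-verts⁻ {X} {x} h with anyFin⁻ (λ e → lookup X e ∧ incident G e x) (trans (sym (lookup∘tabulate _ x)) h)
  ... | e , he = e , lookup⇒[]= e X (proj₁ (∧⁻ he)) , incident⁻ (proj₂ (∧⁻ he))

  ∈-shared⁺ : ∀ {X e f x} → e ∈ X → Incident e x → f ∉ X → Incident f x → x ∈ sharedVerts G X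
  ∈-shared⁺ {X} {x = x} e∈X ex f∉X fx = lookup⇒[]= x _ (trans (lookup∘tabulate _ x)
    (∧⁺ (∈-verts⁺ e∈X ex) (∈-verts⁺ (x∉p⇒x∈∁p f∉X) fx)))

  ∈-shared⁻ : ∀ {X x} → x ∈ sharedVerts G X →
    (∃ λ e → e ∈ X × Incident e x) × (∃ λ f → f ∉ X × Incident f x)
  ∈-shared⁻ {X} {x} x∈ with ∧⁻ (trans (sym (lookup∘tabulate _ x)) ([]=⇒lookup x∈))
  ... | hX , hY with ∈-verts⁻ hY
  ...   | f , f∈ , fx = ∈-verts⁻ hX , f , x∈∁p⇒x∉p f∈ , fx

  separation-∁ : ∀ {k X} → GraphSeparation G k X → GraphSeparation G k (∁ X)
  separation-∁ {k} {X} (hX , hY , hS) = hY , subst (λ Z → k ≤ ∣ Z ∣) (sym (∁-involutive X)) hX ,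
    trans (cong ∣_∣ (tabulate-cong shared-∁)) hS
    where
    shared-∁ : ∀ x → lookup (verts G (∁ X)) x ∧ lookup (verts G (∁ (∁ X))) x ≡ lookup (verts G X) x ∧ lookup (verts G (∁ X)) x
    shared-∁ x = trans (∧-comm (lookup (verts G (∁ X)) x) (lookup (verts G (∁ (∁ X))) x))
      (cong (λ Z → lookup (verts G Z) x ∧ lookup (verts G (∁ X)) x) (∁-involutive X))

  -- The separation consists of the edges with an end w ∉ {s , t} such that Φ w ≡ Φ a.
  not-3-connected : ∀ s t (Φ : V → ℚ) →
    (∀ e → src G e ≢ s → src G e ≢ t → tgt G e ≢ s → tgt G e ≢ t → Φ (src G e) ≡ Φ (tgt G e)) →
    ∀ {e f a c} → Joins e s a → a ≢ s → a ≢ t → Joins f s c → c ≢ s → c ≢ t → Φ a ≢ Φ c →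
    ¬ GraphTutte3Connected G
  not-3-connected s t Φ const {e} {f} {a} {c} esa a≢s a≢t fsc c≢s c≢t Φa≢Φc (_ , noSep) = conclude
    where
    W : V → Set
    W w = w ≢ s × w ≢ t × Φ w ≡ Φ a

    W? : ∀ w → Dec (W w)
    W? w = ¬? (w ≟ s) ×-dec ¬? (w ≟ t) ×-dec (Φ w ℚₚ.≟ Φ a)

    touches? : ∀ g → Dec (W (src G g) ⊎ W (tgt G g))
    touches? g = W? (src G g) ⊎-dec W? (tgt G g)

    Z : Subset (m G)
    Z = comprehension touches?

    ∈Z⁺ : ∀ {g w} → Incident g w → W w → g ∈ Z
    ∈Z⁺ (inj₁ refl) Ww = ∈-comprehension⁺ touches? (inj₁ Ww)
    ∈Z⁺ (inj₂ refl) Ww = ∈-comprehension⁺ touches? (inj₂ Ww)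

    -- A vertex off `s` and `t` on an edge of `Z` is a `W`-end itself or receives the value Φ a
    -- through `const`; then all its edges lie in `Z`.
    shared⊆ : ∀ x → x ∈ sharedVerts G Z → x ≢ t → x ≡ s
    shared⊆ x x∈ x≢t with x ≟ s | ∈-shared⁻ x∈
    ... | yes x≡s | _ = x≡s
    ... | no x≢s | (g , g∈Z , gx) , (h , h∉Z , hx) =
      contradiction (∈Z⁺ hx (x≢s , x≢t , Φx (∈-comprehension⁻ touches? g∈Z) gx)) h∉Z
      where
      Φx : W (src G g) ⊎ W (tgt G g) → Incident g x → Φ x ≡ Φ a
      Φx (inj₁ (_ , _ , p))     (inj₁ refl) = p
      Φx (inj₁ (p , q , r)) (inj₂ refl) = trans (sym (const g p q x≢s x≢t)) r
      Φx (inj₂ (p , q , r)) (inj₁ refl) = trans (const g x≢s x≢t p q) r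
      Φx (inj₂ (_ , _ , p))     (inj₂ refl) = p

    e∈Z : e ∈ Z
    e∈Z = ∈Z⁺ (joins-incidentʳ esa) (a≢s , a≢t , refl)

    f∉Z : f ∉ Z
    f∉Z f∈Z = [ W-end (inj₁ refl) , W-end (inj₂ refl) ]′ (∈-comprehension⁻ touches? f∈Z)
      where
      W-end : ∀ {w} → Incident f w → ¬ W w
      W-end fw (w≢s , _ , p) with joins-ends fsc fw
      ... | inj₁ w≡s  = w≢s w≡s
      ... | inj₂ refl = Φa≢Φc (sym p)

    s∈S : s ∈ sharedVerts G Z
    s∈S = ∈-shared⁺ e∈Z (joins-incidentˡ esa) f∉Z (joins-incidentˡ fsc)

    one : (∀ x → x ∈ sharedVerts G Z → x ≡ s) → Absurd
    one h = noSep 1 Z (s≤s z≤n) (s≤s (s≤s z≤n)) (1≤∣p∣ e∈Z , 1≤∣p∣ (x∉p⇒x∈∁p f∉Z) , ∣p∣≡1 s∈S h)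

    -- The order is 2 or 1 according to whether `t` is a second shared vertex. In the former case
    -- `e` and `f` avoid `t`, so an edge at `t` on each side is the second element of that side.
    conclude : Absurd
    conclude with t ≟ s | t ∈? sharedVerts G Z
    ... | yes refl | _      = one (λ x x∈ → decidable-stable (x ≟ s) (λ x≢s → x≢s (shared⊆ x x∈ x≢s)))
    ... | no _     | no t∉S = one (λ x x∈ → shared⊆ x x∈ (λ { refl → t∉S x∈ }))
    ... | no t≢s   | yes t∈S with ∈-shared⁻ t∈S
    ...   | (g , g∈Z , gt) , (h , h∉Z , ht) = noSep 2 Z (s≤s z≤n) (s≤s (s≤s (s≤s z≤n)))
      ( 2≤∣p∣ e∈Z g∈Z (λ { refl → distinct esa a≢t gt })
      , 2≤∣p∣ (x∉p⇒x∈∁p f∉Z) (x∉p⇒x∈∁p h∉Z) (λ { refl → distinct fsc c≢t ht })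
      , ∣p∣≡2 s∈S t∈S t≢s only)
      where
      distinct : ∀ {g y} → Joins g s y → y ≢ t → ¬ Incident g t
      distinct gsy y≢t gt = [ t≢s , y≢t ∘ sym ]′ (joins-ends gsy gt)

      only : ∀ x → x ∈ sharedVerts G Z → x ≡ s ⊎ x ≡ t
      only x x∈ with x ≟ t
      ... | yes x≡t = inj₂ x≡t
      ... | no x≢t  = inj₁ (shared⊆ x x∈ x≢t)

  walk-invariant : ∀ {A : Set} (Φ : V → A) {ok : V → Set} → (∀ e → Φ (src G e) ≡ Φ (tgt G e)) →
    ∀ {x y} → Walk G ok x y → Φ x ≡ Φ y
  walk-invariant Φ h (here _)       = refl
  walk-invariant Φ h (stepF e _ w)  = trans (h e) (walk-invariant Φ h w)
  walk-invariant Φ h (stepB e _ w)  = trans (sym (h e)) (walk-invariant Φ h w)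

  walk-start : ∀ {ok x y} → Walk G ok x y → ok x
  walk-start (here okx)      = okx
  walk-start (stepF _ okx _) = okx
  walk-start (stepB _ okx _) = okx

  walk-++ : ∀ {ok x y z} → Walk G ok x y → Walk G ok y z → Walk G ok x z
  walk-++ (here _)          w' = w'
  walk-++ (stepF e okx w)   w' = stepF e okx (walk-++ w w')
  walk-++ (stepB e okx w)   w' = stepB e okx (walk-++ w w')

  firstEdge : ∀ {ok x y} → Walk G ok x y → x ≢ y → ∃ λ e → Incident e x
  firstEdge (here _)      x≢x = contradiction refl x≢x
  firstEdge (stepF e _ _) _   = e , inj₁ refl
  firstEdge (stepB e _ _) _   = e , inj₂ refl

  -- Along the walk, `P` passes from each vertex to the next unless the current one has `Q` as well;
  -- at the latest, the endpoint has both.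
  walk-mixed : ∀ {ok} {P Q : V → Set} → (∀ e x y → Joins e x y → ok x → ok y → Q x ⊎ P y) →
    ∀ {x y} → Walk G ok x y → P x → Q y → ∃ λ z → ok z × P z × Q z
  walk-mixed h (here okx) Px Qx = _ , okx , Px , Qx
  walk-mixed h (stepF e okx w) Px Qy with h e _ _ (inj₁ (refl , refl)) okx (walk-start w)
  ... | inj₁ Qx = _ , okx , Px , Qx
  ... | inj₂ Px' = walk-mixed h w Px' Qy
  walk-mixed h (stepB e okx w) Px Qy with h e _ _ (inj₂ (refl , refl)) okx (walk-start w)
  ... | inj₁ Qx = _ , okx , Px , Qx
  ... | inj₂ Px' = walk-mixed h w Px' Qy

  -- Walks are infinitely many; reachability through the edges of a list is decidable by recursion on the list.
  module Reachability {ok : V → Set} (ok? : ∀ x → Dec (ok x)) where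

    Reach : List E → V → V → Set
    Reach List.[]       x y = x ≡ y
    Reach (e List.∷ L) x y = Reach L x y
      ⊎ (ok (src G e) × ok (tgt G e)) ×
        (Reach L x (src G e) × Reach L (tgt G e) y ⊎ Reach L x (tgt G e) × Reach L (src G e) y)

    reach? : ∀ L x y → Dec (Reach L x y)
    reach? List.[]      x y = x ≟ y
    reach? (e List.∷ L) x y = reach? L x y
      ⊎-dec ((ok? (src G e) ×-dec ok? (tgt G e)) ×-dec
        ((reach? L x (src G e) ×-dec reach? L (tgt G e) y) ⊎-dec (reach? L x (tgt G e) ×-dec reach? L (src G e) y)))

    reach-refl : ∀ L {x} → Reach L x x
    reach-refl List.[]      = refl
    reach-refl (e List.∷ L) = inj₁ (reach-refl L)

    -- Two passages through `e` reduce to at most one: in the same direction, the detour between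
    -- them is cut out together with one passage; in opposite directions, both passages are dropped.
    reach-trans : ∀ L {x y z} → Reach L x y → Reach L y z → Reach L x z
    reach-trans List.[]      p q = trans p q
    reach-trans (e List.∷ L) (inj₁ p) (inj₁ q) = inj₁ (reach-trans L p q)
    reach-trans (e List.∷ L) (inj₁ p) (inj₂ (o , inj₁ (q , r))) = inj₂ (o , inj₁ (reach-trans L p q , r))
    reach-trans (e List.∷ L) (inj₁ p) (inj₂ (o , inj₂ (q , r))) = inj₂ (o , inj₂ (reach-trans L p q , r))
    reach-trans (e List.∷ L) (inj₂ (o , inj₁ (p , q))) (inj₁ r) = inj₂ (o , inj₁ (p , reach-trans L q r))
    reach-trans (e List.∷ L) (inj₂ (o , inj₂ (p , q))) (inj₁ r) = inj₂ (o , inj₂ (p , reach-trans L q r))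
    reach-trans (e List.∷ L) (inj₂ (o , inj₁ (p , _))) (inj₂ (_ , inj₁ (_ , s))) = inj₂ (o , inj₁ (p , s))
    reach-trans (e List.∷ L) (inj₂ (o , inj₁ (p , _))) (inj₂ (_ , inj₂ (_ , s))) = inj₁ (reach-trans L p s)
    reach-trans (e List.∷ L) (inj₂ (o , inj₂ (p , _))) (inj₂ (_ , inj₁ (_ , s))) = inj₁ (reach-trans L p s)
    reach-trans (e List.∷ L) (inj₂ (o , inj₂ (p , _))) (inj₂ (_ , inj₂ (_ , s))) = inj₂ (o , inj₂ (p , s))

    reach-edge : ∀ L {e x y} → e L.∈ L → Joins e x y → ok x → ok y → Reach L x y
    reach-edge (e List.∷ L) (here refl) (inj₁ (refl , refl)) okx oky = inj₂ ((okx , oky) , inj₁ (reach-refl L , reach-refl L))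
    reach-edge (e List.∷ L) (here refl) (inj₂ (refl , refl)) okx oky = inj₂ ((oky , okx) , inj₂ (reach-refl L , reach-refl L))
    reach-edge (_ List.∷ L) (there e∈)  exy okx oky = inj₁ (reach-edge L e∈ exy okx oky)

    reach⇒walk : ∀ L {x y} → ok x → Reach L x y → Walk G ok x y
    reach⇒walk List.[]      okx refl     = here okx
    reach⇒walk (e List.∷ L) okx (inj₁ p) = reach⇒walk L okx p
    reach⇒walk (e List.∷ L) okx (inj₂ ((os , ot) , inj₁ (p , q))) = walk-++ (reach⇒walk L okx p) (stepF e os (reach⇒walk L ot q))
    reach⇒walk (e List.∷ L) okx (inj₂ ((os , ot) , inj₂ (p , q))) = walk-++ (reach⇒walk L okx p) (stepB e ot (reach⇒walk L os q))

-- Lists without repetition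

lookup-injective : ∀ {A : Set} {xs : List A} → Unique xs → ∀ i j → List.lookup xs i ≡ List.lookup xs j → i ≡ j
lookup-injective (_ ∷ _)  zero    zero    h = refl
lookup-injective {xs = _ List.∷ xs} (x∉ ∷ _) zero (suc j) h = contradiction h (LAll.lookup x∉ (Lₚ.∈-lookup {xs = xs} j))
lookup-injective {xs = _ List.∷ xs} (x∉ ∷ _) (suc i) zero h = contradiction (sym h) (LAll.lookup x∉ (Lₚ.∈-lookup {xs = xs} i))
lookup-injective (_ ∷ u)  (suc i) (suc j) h = cong suc (lookup-injective u i j h)

concatMap-unique : ∀ {A B : Set} (f : A → List B) {xs} → (∀ x → Unique (f x)) →
  (∀ {x y z} → z L.∈ f x → z L.∈ f y → x ≡ y) → Unique xs → Unique (List.concatMap f xs)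
concatMap-unique f {xs} unique disjoint u = Uniqueₚ.concat⁺ (LAllₚ.map⁺ (LAll.universal unique xs))
  (AllPairsₚ.map⁺ (AllPairs.map (λ x≢y {_} p → x≢y (disjoint (proj₁ p) (proj₂ p))) u))

isYes⁺ : ∀ {P : Set} (P? : Dec P) → P → isYes P? ≡ true
isYes⁺ (yes _) _ = refl
isYes⁺ (no ¬p) p = contradiction p ¬p

isYes⁻ : ∀ {P : Set} (P? : Dec P) → isYes P? ≡ true → P
isYes⁻ (yes p) _ = p

∈-if⁻ : ∀ {A : Set} {x y : A} c → y L.∈ (if c then x List.∷ List.[] else List.[]) → c ≡ true × y ≡ x
∈-if⁻ true (here p) = refl , p

if-unique : ∀ {A : Set} {x : A} c → Unique (if c then x List.∷ List.[] else List.[])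
if-unique true  = LAll.[] ∷ []
if-unique false = []

neg-cancel : ∀ {x y x' y' : ℚ} → x + y ≡ 0ℚ → x' + y' ≡ 0ℚ → y ≡ y' → x ≡ x'
neg-cancel {x} {y} {x'} h h' refl = ∙-cancelʳ ℚₚ.+-0-group y x x' (trans h (sym h'))

-- The graph Γ̂ and the Dirichlet matroid of a network

module BoundaryPairs (N : Network) where

  admissible : Fin (n (Γ N)) → Fin (n (Γ N)) → Bool
  admissible a b = isB N a ∧ isB N b ∧ isYes (toℕ a ℕₚ.<? toℕ b)

  row : Fin (n (Γ N)) → List (Fin (n (Γ N)) × Fin (n (Γ N)))
  row a = List.concatMap (λ b → if admissible a b then (a , b) List.∷ List.[] else List.[]) (List.allFin _)

  ∈-row⁻ : ∀ {a p} → p L.∈ row a → proj₁ p ≡ a × admissible (proj₁ p) (proj₂ p) ≡ true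
  ∈-row⁻ {a} p∈ with satisfied (Lₚ.∈-concatMap⁻ (λ b → if admissible a b then (a , b) List.∷ List.[] else List.[]) {xs = List.allFin _} p∈)
  ... | b , p∈b with ∈-if⁻ (admissible a b) p∈b
  ...   | adm , refl = refl , adm

  ∈-boundaryPairs⁻ : ∀ {p} → p L.∈ boundaryPairs N → admissible (proj₁ p) (proj₂ p) ≡ true
  ∈-boundaryPairs⁻ p∈ with satisfied (Lₚ.∈-concatMap⁻ row {xs = List.allFin _} p∈)
  ... | a , p∈a = proj₂ (∈-row⁻ p∈a)

  ∈-boundaryPairs⁺ : ∀ {a b} → admissible a b ≡ true → (a , b) L.∈ boundaryPairs N
  ∈-boundaryPairs⁺ {a} {b} adm = Lₚ.∈-concatMap⁺ row (L.lose (Lₚ.∈-allFin a)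
    (Lₚ.∈-concatMap⁺ _ (L.lose (Lₚ.∈-allFin b) (subst (λ c → (a , b) L.∈ (if c then _ else _)) (sym adm) (here refl)))))

  -- Different rows differ in the first component, entries of one row in the second. This makes
  -- distinct clique edges differ in their ends, as `clique-third` requires.
  boundaryPairs-unique : Unique (boundaryPairs N)
  boundaryPairs-unique = concatMap-unique row row-unique
    (λ p∈a p∈b → trans (sym (proj₁ (∈-row⁻ p∈a))) (proj₁ (∈-row⁻ p∈b))) (Uniqueₚ.allFin⁺ _)
    where
    row-unique : ∀ a → Unique (row a)
    row-unique a = concatMap-unique _ (λ b → if-unique (admissible a b))
      (λ {x} {y} p∈x p∈y → cong proj₂ (trans (sym (proj₂ (∈-if⁻ (admissible a x) p∈x))) (proj₂ (∈-if⁻ (admissible a y) p∈y)))) (Uniqueₚ.allFin⁺ _)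

module NetworkLemmas (N : Network) (net : IsNetwork N) (u : Fin (n (Γ N)) → ℚ) (u-inj : InjectiveOnB N u) where

  open GraphLemmas (Γ N) public
  open BoundaryPairs N public
  module H = GraphLemmas (hatΓ N)

  noLoop : ∀ e → src (Γ N) e ≢ tgt (Γ N) e
  noLoop = proj₁ (proj₁ net)

  joins-≢ : ∀ {e x y} → Joins e x y → y ≢ x
  joins-≢ {e} (inj₁ (refl , refl)) p = noLoop e (sym p)
  joins-≢ {e} (inj₂ (refl , refl)) p = noLoop e p

  joins-unique : ∀ {e f x y} → Joins e x y → Joins f x y → e ≡ f
  joins-unique {e} {f} (inj₁ (p , q)) (inj₁ (p' , q')) = proj₂ (proj₁ net) e f (inj₁ (trans p (sym p') , trans q (sym q')))
  joins-unique {e} {f} (inj₁ (p , q)) (inj₂ (p' , q')) = proj₂ (proj₁ net) e f (inj₂ (trans p (sym q') , trans q (sym p')))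
  joins-unique {e} {f} (inj₂ (p , q)) (inj₁ (p' , q')) = proj₂ (proj₁ net) e f (inj₂ (trans p (sym q') , trans q (sym p')))
  joins-unique {e} {f} (inj₂ (p , q)) (inj₂ (p' , q')) = proj₂ (proj₁ net) e f (inj₁ (trans p (sym p') , trans q (sym q')))

  joins-sym : ∀ {e x y} → Joins e x y → Joins e y x
  joins-sym = swap

  Γ-connected : Connected (Γ N)
  Γ-connected = proj₁ (proj₂ net)

  b₁ b₂ i₀ : V
  b₁ = proj₁ (proj₁ (proj₂ (proj₂ net)))
  b₂ = proj₁ (proj₂ (proj₁ (proj₂ (proj₂ net))))
  i₀ = proj₁ (proj₁ (proj₂ (proj₂ (proj₂ net))))

  b₁≢b₂ : b₁ ≢ b₂
  b₁≢b₂ = proj₁ (proj₂ (proj₂ (proj₁ (proj₂ (proj₂ net)))))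

  b₁-bnd : Bnd N b₁
  b₁-bnd = proj₁ (proj₂ (proj₂ (proj₂ (proj₁ (proj₂ (proj₂ net))))))

  b₂-bnd : Bnd N b₂
  b₂-bnd = proj₂ (proj₂ (proj₂ (proj₂ (proj₁ (proj₂ (proj₂ net))))))

  i₀-int : Int N i₀
  i₀-int = proj₂ (proj₁ (proj₂ (proj₂ (proj₂ net))))

  boundary-independent : ∀ e → Bnd N (src (Γ N) e) → Bnd N (tgt (Γ N) e) → Absurd
  boundary-independent = proj₂ (proj₂ (proj₂ (proj₂ net)))

  bnd⊎int : ∀ x → Bnd N x ⊎ Int N x
  bnd⊎int x with isB N x
  ... | true  = inj₁ refl
  ... | false = inj₂ refl

  bnd-int : ∀ {x} → Bnd N x → Int N x → Absurd
  bnd-int p q with trans (sym p) q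
  ... | ()

  bnd-≢-int : ∀ {x y} → Bnd N x → Int N y → x ≢ y
  bnd-≢-int p q refl = bnd-int p q

  joins-int : ∀ {e x y} → Joins e x y → Bnd N x → Int N y
  joins-int {e} {x} {y} exy bx with bnd⊎int y
  ... | inj₂ iy = iy
  ... | inj₁ by with exy
  ...   | inj₁ (refl , refl) = ⊥-elim (boundary-independent e bx by)
  ...   | inj₂ (refl , refl) = ⊥-elim (boundary-independent e by bx)

  interiorEnd : ∀ e → ∃ λ x → Incident e x × Int N x
  interiorEnd e with bnd⊎int (src (Γ N) e)
  ... | inj₁ b = tgt (Γ N) e , inj₂ refl , joins-int (inj₁ (refl , refl)) b
  ... | inj₂ i = src (Γ N) e , inj₁ refl , i

  otherBnd : ∀ x → ∃ λ b → Bnd N b × b ≢ x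
  otherBnd x with b₁ ≟ x
  ... | yes p = b₂ , b₂-bnd , λ q → b₁≢b₂ (trans p (sym q))
  ... | no ¬p = b₁ , b₁-bnd , ¬p

  edgeAt : ∀ x → ∃ λ e → Incident e x
  edgeAt x with otherBnd x
  ... | b , _ , b≢x = firstEdge (proj₂ Γ-connected x b _ _) (b≢x ∘ sym)

  ℓ : ℕ
  ℓ = List.length (boundaryPairs N)

  lift : E → H.E
  lift e = e ↑ˡ ℓ

  clique : Fin ℓ → H.E
  clique i = m (Γ N) ↑ʳ i

  pair : Fin ℓ → V × V
  pair = List.lookup (boundaryPairs N)

  src-lift : ∀ e → src (hatΓ N) (lift e) ≡ src (Γ N) e
  src-lift e rewrite splitAt-↑ˡ (m (Γ N)) e ℓ = refl

  tgt-lift : ∀ e → tgt (hatΓ N) (lift e) ≡ tgt (Γ N) e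
  tgt-lift e rewrite splitAt-↑ˡ (m (Γ N)) e ℓ = refl

  src-clique : ∀ i → src (hatΓ N) (clique i) ≡ proj₁ (pair i)
  src-clique i rewrite splitAt-↑ʳ (m (Γ N)) ℓ i = refl

  tgt-clique : ∀ i → tgt (hatΓ N) (clique i) ≡ proj₂ (pair i)
  tgt-clique i rewrite splitAt-↑ʳ (m (Γ N)) ℓ i = refl

  data HatEdge : H.E → Set where
    lifted : ∀ e → HatEdge (lift e)
    paired : ∀ i → HatEdge (clique i)

  hatEdge : ∀ e → HatEdge e
  hatEdge e with splitAt (m (Γ N)) e in eq
  ... | inj₁ e' = subst HatEdge (splitAt⁻¹-↑ˡ eq) (lifted e')
  ... | inj₂ i  = subst HatEdge (splitAt⁻¹-↑ʳ eq) (paired i)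

  lift≢clique : ∀ {e i} → lift e ≢ clique i
  lift≢clique {e} {i} p with trans (sym (splitAt-↑ˡ (m (Γ N)) e ℓ)) (trans (cong (splitAt (m (Γ N))) p) (splitAt-↑ʳ (m (Γ N)) ℓ i))
  ... | ()

  lift-incident⁺ : ∀ {e x} → Incident e x → H.Incident (lift e) x
  lift-incident⁺ {e} = [ (λ p → inj₁ (trans (src-lift e) p)) , (λ p → inj₂ (trans (tgt-lift e) p)) ]′

  lift-incident⁻ : ∀ {e x} → H.Incident (lift e) x → Incident e x
  lift-incident⁻ {e} = [ (λ p → inj₁ (trans (sym (src-lift e)) p)) , (λ p → inj₂ (trans (sym (tgt-lift e)) p)) ]′

  lift-joins⁺ : ∀ {e x y} → Joins e x y → H.Joins (lift e) x y
  lift-joins⁺ {e} (inj₁ (p , q)) = inj₁ (trans (src-lift e) p , trans (tgt-lift e) q)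
  lift-joins⁺ {e} (inj₂ (p , q)) = inj₂ (trans (src-lift e) p , trans (tgt-lift e) q)

  pair-admissible : ∀ i → Bnd N (proj₁ (pair i)) × Bnd N (proj₂ (pair i)) × toℕ (proj₁ (pair i)) < toℕ (proj₂ (pair i))
  pair-admissible i with ∧⁻ {isB N (proj₁ (pair i))} (∈-boundaryPairs⁻ (Lₚ.∈-lookup {xs = boundaryPairs N} i))
  ... | p , q with ∧⁻ {isB N (proj₂ (pair i))} q
  ...   | r , s = p , r , isYes⁻ (toℕ (proj₁ (pair i)) ℕₚ.<? toℕ (proj₂ (pair i))) s

  clique-joins : ∀ i → H.Joins (clique i) (proj₁ (pair i)) (proj₂ (pair i))
  clique-joins i = inj₁ (src-clique i , tgt-clique i)

  clique-bnd : ∀ {i x} → H.Incident (clique i) x → Bnd N x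
  clique-bnd {i} inc with H.joins-ends (clique-joins i) inc
  ... | inj₁ refl = proj₁ (pair-admissible i)
  ... | inj₂ refl = proj₁ (proj₂ (pair-admissible i))

  clique-≢ : ∀ i → proj₂ (pair i) ≢ proj₁ (pair i)
  clique-≢ i p = ℕₚ.<⇒≢ (proj₂ (proj₂ (pair-admissible i))) (cong toℕ (sym p))

  clique-edge : ∀ {a b} → Bnd N a → Bnd N b → a ≢ b → ∃ λ i → H.Joins (clique i) a b
  clique-edge {a} {b} ba bb a≢b with ℕₚ.<-cmp (toℕ a) (toℕ b)
  ... | tri≈ _ p _ = contradiction (toℕ-injective p) a≢b
  ... | tri< a<b _ _ = index p∈ , subst (λ p → H.Joins (clique (index p∈)) (proj₁ p) (proj₂ p)) (sym (Anyₚ.lookup-index p∈)) (clique-joins (index p∈))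
    where p∈ = ∈-boundaryPairs⁺ (∧⁺ ba (∧⁺ bb (isYes⁺ (toℕ a ℕₚ.<? toℕ b) a<b)))
  ... | tri> _ _ b<a = index p∈ , subst (λ p → H.Joins (clique (index p∈)) (proj₂ p) (proj₁ p)) (sym (Anyₚ.lookup-index p∈)) (swap (clique-joins (index p∈)))
    where p∈ = ∈-boundaryPairs⁺ (∧⁺ bb (∧⁺ ba (isYes⁺ (toℕ b ℕₚ.<? toℕ a) b<a)))

  -- Clique edges are not loops, so if both ends of `j` were ends of `i`, the two pairs would agree
  -- or be reversed. The former contradicts the uniqueness of the list, the latter the order of the
  -- ends.
  clique-third : ∀ {i j} → i ≢ j → ∃ λ z → H.Incident (clique j) z × z ≢ proj₁ (pair i) × z ≢ proj₂ (pair i)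
  clique-third {i} {j} i≢j with proj₁ (pair j) ≟ proj₁ (pair i) | proj₁ (pair j) ≟ proj₂ (pair i)
  ... | no p  | no q  = _ , H.joins-incidentˡ (clique-joins j) , p , q
  ... | yes p | _     = _ , H.joins-incidentʳ (clique-joins j) , (λ q → clique-≢ j (trans q (sym p))) ,
    (λ q → i≢j (lookup-injective boundaryPairs-unique i j (cong₂ _,_ (sym p) (sym q))))
  ... | no _  | yes p = _ , H.joins-incidentʳ (clique-joins j) ,
    (λ q → ℕₚ.<-asym (proj₂ (proj₂ (pair-admissible i))) (subst₂ (λ x y → toℕ x < toℕ y) p q (proj₂ (proj₂ (pair-admissible j))))) ,
    (λ q → clique-≢ j (trans q (sym p)))

  -- Restricts to φ on interior vertices; the coordinates of φ at boundary vertices are ignored.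
  ext : (Fin (suc (n (Γ N))) → ℚ) → V → ℚ
  ext φ x = if isB N x then u x * φ zero else φ (suc x)

  ext-bnd : ∀ φ {x} → Bnd N x → ext φ x ≡ u x * φ zero
  ext-bnd φ p rewrite p = refl

  ext-int : ∀ φ {x} → Int N x → ext φ x ≡ φ (suc x)
  ext-int φ p rewrite p = refl

  ext-+ : ∀ {φ ψ χ} → (∀ t → φ t + ψ t ≡ χ t) → ∀ x → ext φ x + ext ψ x ≡ ext χ x
  ext-+ {φ} {ψ} h x with isB N x
  ... | true  = trans (sym (ℚₚ.*-distribˡ-+ (u x) (φ zero) (ψ zero))) (cong (u x *_) (h zero))
  ... | false = h (suc x)

  open Vectors (dirichletVec N u) public

  ·-difference : ∀ {d} (φ : Fin d → ℚ) i j z → φ · (λ t → unit i t + (- (z * unit j t))) ≡ φ i + (- (z * φ j))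
  ·-difference φ i j z = begin
    φ · (λ t → unit i t + (- (z * unit j t)))        ≡⟨ ·-comm φ _ ⟩
    (λ t → unit i t + (- (z * unit j t))) · φ        ≡⟨ ·-+ˡ (unit i) (λ t → - (z * unit j t)) φ ⟩
    unit i · φ + (λ t → - (z * unit j t)) · φ        ≡⟨ cong₂ _+_ (unit-· i φ) (trans (·-negˡ (λ t → z * unit j t) φ) (cong -_ (trans (·-*ˡ z (unit j) φ) (cong (z *_) (unit-· j φ))))) ⟩
    φ i + (- (z * φ j))                              ∎
    where open ≡-Reasoning

  -- The clauses of `edgeVec` as equations, so that later proofs need not unfold its case split.
  data EdgeType (e : E) : Set where
    II : Int N (src (Γ N) e) → Int N (tgt (Γ N) e) →
      (∀ t → edgeVec N u e t ≡ unit (suc (src (Γ N) e)) t + (- unit (suc (tgt (Γ N) e)) t)) → EdgeType e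
    IB : Int N (src (Γ N) e) → Bnd N (tgt (Γ N) e) →
      (∀ t → edgeVec N u e t ≡ unit (suc (src (Γ N) e)) t + (- (u (tgt (Γ N) e) * unit zero t))) → EdgeType e
    BI : Bnd N (src (Γ N) e) → Int N (tgt (Γ N) e) →
      (∀ t → edgeVec N u e t ≡ unit (suc (tgt (Γ N) e)) t + (- (u (src (Γ N) e) * unit zero t))) → EdgeType e

  edgeType : ∀ e → EdgeType e
  edgeType e with bnd⊎int (src (Γ N) e) | bnd⊎int (tgt (Γ N) e)
  ... | inj₁ p | inj₁ q = ⊥-elim (boundary-independent e p q)
  ... | inj₁ p | inj₂ q = BI p q eq
    where
    eq : ∀ t → edgeVec N u e t ≡ unit (suc (tgt (Γ N) e)) t + (- (u (src (Γ N) e) * unit zero t))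
    eq t rewrite p | q = refl
  ... | inj₂ p | inj₁ q = IB p q eq
    where
    eq : ∀ t → edgeVec N u e t ≡ unit (suc (src (Γ N) e)) t + (- (u (tgt (Γ N) e) * unit zero t))
    eq t rewrite p | q = refl
  ... | inj₂ p | inj₂ q = II p q eq
    where
    eq : ∀ t → edgeVec N u e t ≡ unit (suc (src (Γ N) e)) t + (- unit (suc (tgt (Γ N) e)) t)
    eq t rewrite p | q = refl

  -- The unit vector of an interior end reads off φ there, and `u b` times the e₀-vector reads off
  -- the potential at `b`. The sign flips when the source is a boundary node, since the interior end
  -- always comes first.
  edge-pairing : ∀ φ e → φ · edgeVec N u e ≡ ext φ (src (Γ N) e) + (- ext φ (tgt (Γ N) e))
    ⊎ φ · edgeVec N u e ≡ ext φ (tgt (Γ N) e) + (- ext φ (src (Γ N) e))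
  edge-pairing φ e with edgeType e
  ... | II p q eq = inj₁ (trans (∑-cong (λ t → cong (φ t *_) (trans (eq t) (cong (λ x → unit (suc (src (Γ N) e)) t + (- x)) (sym (ℚₚ.*-identityˡ _))))))
    (trans (·-difference φ _ (suc (tgt (Γ N) e)) 1ℚ) (cong₂ (λ x y → x + (- y)) (sym (ext-int φ p)) (trans (ℚₚ.*-identityˡ _) (sym (ext-int φ q))))))
  ... | IB p q eq = inj₁ (trans (∑-cong (λ t → cong (φ t *_) (eq t)))
    (trans (·-difference φ _ zero (u (tgt (Γ N) e))) (cong₂ (λ x y → x + (- y)) (sym (ext-int φ p)) (sym (ext-bnd φ q)))))
  ... | BI p q eq = inj₂ (trans (∑-cong (λ t → cong (φ t *_) (eq t)))
    (trans (·-difference φ _ zero (u (src (Γ N) e))) (cong₂ (λ x y → x + (- y)) (sym (ext-int φ q)) (sym (ext-bnd φ p)))))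

  difference-zero : ∀ {x y} → x + (- y) ≡ 0ℚ → x ≡ y
  difference-zero {x} {y} h = ∙-cancelʳ ℚₚ.+-0-group (- y) x y (trans h (sym (ℚₚ.+-inverseʳ y)))

  kills-edge : ∀ {φ X} → Kills φ X → ∀ e → suc e ∈ X → ext φ (src (Γ N) e) ≡ ext φ (tgt (Γ N) e)
  kills-edge {φ} kills e e∈X with edge-pairing φ e
  ... | inj₁ p = difference-zero (trans (sym p) (kills (suc e) e∈X))
  ... | inj₂ p = sym (difference-zero (trans (sym p) (kills (suc e) e∈X)))

  kills-e₀ : ∀ {φ X} → Kills φ X → zero ∈ X → φ zero ≡ 0ℚ
  kills-e₀ {φ} kills z∈X = trans (sym (trans (·-comm φ (unit zero)) (unit-· zero φ))) (kills zero z∈X)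

  kills⁺ : ∀ {φ X} → (zero ∈ X → φ zero ≡ 0ℚ) → (∀ e → suc e ∈ X → ext φ (src (Γ N) e) ≡ ext φ (tgt (Γ N) e)) → Kills φ X
  kills⁺ {φ} h₀ h zero    z∈X = trans (·-comm φ (unit zero)) (trans (unit-· zero φ) (h₀ z∈X))
  kills⁺ {φ} h₀ h (suc e) e∈X with edge-pairing φ e
  ... | inj₁ p = trans p (trans (cong (λ x → x + (- ext φ (tgt (Γ N) e))) (h e e∈X)) (ℚₚ.+-inverseʳ (ext φ (tgt (Γ N) e))))
  ... | inj₂ p = trans p (trans (cong (λ x → ext φ (tgt (Γ N) e) + (- x)) (h e e∈X)) (ℚₚ.+-inverseʳ (ext φ (tgt (Γ N) e))))

  -- The coordinates of boundary nodes belong to the encoding only: all vectors of the matroid are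
  -- zero there.
  D : Subset (suc (n (Γ N)))
  D = true ∷ tabulate (λ x → not (isB N x))

  zero∈D : zero ∈ D
  zero∈D = here

  ∉D : ∀ {t} → t ∉ D → ∃ λ x → t ≡ suc x × Bnd N x
  ∉D {zero}  t∉D = contradiction zero∈D t∉D
  ∉D {suc x} t∉D with bnd⊎int x
  ... | inj₁ b = x , refl , b
  ... | inj₂ i = contradiction (there (lookup⇒[]= x _ (trans (lookup∘tabulate (λ x → not (isB N x)) x) (cong not i)))) t∉D

  v-supp : ∀ k t → t ∉ D → dirichletVec N u k t ≡ 0ℚ
  v-supp k t t∉D with ∉D t∉D
  v-supp zero    _ t∉D | x , refl , b = refl
  v-supp (suc e) _ t∉D | x , refl , b with edgeType e
  ... | II p q eq = trans (eq (suc x)) (cong₂ (λ y z → y + (- z)) (off p) (off q))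
    where
    off : ∀ {y} → Int N y → unit (suc y) (suc x) ≡ 0ℚ
    off iy = unit-≢ (bnd-≢-int b iy ∘ sym ∘ suc-injective)
  ... | IB p q eq = trans (eq (suc x)) (cong₂ (λ y z → y + (- z)) (unit-≢ (bnd-≢-int b p ∘ sym ∘ suc-injective)) (ℚₚ.*-zeroʳ (u (tgt (Γ N) e))))
  ... | BI p q eq = trans (eq (suc x)) (cong₂ (λ y z → y + (- z)) (unit-≢ (bnd-≢-int b q ∘ sym ∘ suc-injective)) (ℚₚ.*-zeroʳ (u (src (Γ N) e))))

  -- Killing e₀ gives φ₀ = 0, so the potential vanishes on `B`; being constant along all edges of
  -- the connected graph Γ, it vanishes everywhere.
  spanning : ∀ φ → (∀ t → t ∉ D → φ t ≡ 0ℚ) → (∀ k → φ · dirichletVec N u k ≡ 0ℚ) → ∀ t → φ t ≡ 0ℚ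
  spanning φ supp kills = vanish
    where
    φ₀≡0 : φ zero ≡ 0ℚ
    φ₀≡0 = kills-e₀ {φ} {⊤} (λ k _ → kills k) ∈⊤

    ext≡0 : ∀ x → ext φ x ≡ 0ℚ
    ext≡0 x = trans (walk-invariant (ext φ) (λ e → kills-edge {φ} {⊤} (λ k _ → kills k) e ∈⊤) (proj₂ Γ-connected x b₁ _ _))
      (trans (ext-bnd φ b₁-bnd) (trans (cong (u b₁ *_) φ₀≡0) (ℚₚ.*-zeroʳ (u b₁))))

    vanish : ∀ t → φ t ≡ 0ℚ
    vanish zero    = φ₀≡0
    vanish (suc x) with bnd⊎int x
    ... | inj₁ b = supp (suc x) (λ x∈D → bnd-int b (int x∈D))
      where
      int : suc x ∈ D → Int N x
      int (there x∈) = trans (sym (not-involutive (isB N x)))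
        (cong not (trans (sym (lookup∘tabulate (λ x → not (isB N x)) x)) ([]=⇒lookup x∈)))
    ... | inj₂ i = trans (sym (ext-int φ i)) (ext≡0 x)

  open Spanning D v-supp spanning public

-- From the graph to the matroid

module Sufficiency (N : Network) (net : IsNetwork N) (u : Fin (n (Γ N)) → ℚ) (u-inj : InjectiveOnB N u)
  (interior-connected : InteriorConnected N) (hat-3-connected : GraphTutte3Connected (hatΓ N)) where

  open NetworkLemmas N net u u-inj

  module Side (X : Subset (suc (m (Γ N)))) (e₀∉X : zero ∉ X) where

    ConstX ConstY : (V → ℚ) → Set
    ConstX Φ = ∀ e → suc e ∈ X → Φ (src (Γ N) e) ≡ Φ (tgt (Γ N) e)
    ConstY Ψ = ∀ e → suc e ∉ X → Ψ (src (Γ N) e) ≡ Ψ (tgt (Γ N) e)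

    TouchX TouchY Mixed : V → Set
    TouchX x = ∃ λ e → suc e ∈ X × Incident e x
    TouchY x = ∃ λ e → suc e ∉ X × Incident e x
    Mixed x = Int N x × TouchX x × TouchY x

    VanishOffPair : V → V → (V → ℚ) → (V → ℚ) → Set
    VanishOffPair s t Φ Ψ = ∀ x → x ≢ s → x ≢ t → Φ x + Ψ x ≡ 0ℚ

    -- Off `s` and `t` one has Φ = -Ψ, so along edges avoiding them Φ is constant: on `X`, on its
    -- complement, and on the boundary clique, where Ψ is zero. If Φ a were Φ c, then Φ s + Ψ s = Φ
    -- a + Ψ c = Φ c + Ψ c = 0. So Φ separates two neighbours of `s`.
    pair-cut : ∀ {Φ Ψ s t} → ConstX Φ → ConstY Ψ → (∀ x → Bnd N x → Ψ x ≡ 0ℚ) → VanishOffPair s t Φ Ψ → Φ s + Ψ s ≢ 0ℚ →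
      ∀ {e a f c} → suc e ∈ X → Joins e s a → a ≢ t → H.Joins f s c → c ≢ s → c ≢ t → Ψ c ≡ Ψ s → Absurd
    pair-cut {Φ} {Ψ} {s} {t} constX constY zeroB off nz e∈X esa a≢t fsc c≢s c≢t Ψc≡Ψs =
      H.not-3-connected s t Φ const (lift-joins⁺ esa) (joins-≢ esa) a≢t fsc c≢s c≢t
        (λ Φa≡Φc → nz (trans (cong₂ _+_ (trans (joins-const Φ (constX _ e∈X) esa) Φa≡Φc) (sym Ψc≡Ψs)) (off _ c≢s c≢t)))
        hat-3-connected
      where
      constLift : ∀ e → src (Γ N) e ≢ s → src (Γ N) e ≢ t → tgt (Γ N) e ≢ s → tgt (Γ N) e ≢ t →
        Φ (src (Γ N) e) ≡ Φ (tgt (Γ N) e)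
      constLift e p q p' q' with suc e ∈? X
      ... | yes e∈X = constX e e∈X
      ... | no e∉X  = neg-cancel (off _ p q) (off _ p' q') (constY e e∉X)

      const : ∀ e → src (hatΓ N) e ≢ s → src (hatΓ N) e ≢ t → tgt (hatΓ N) e ≢ s → tgt (hatΓ N) e ≢ t →
        Φ (src (hatΓ N) e) ≡ Φ (tgt (hatΓ N) e)
      const e p q p' q' with hatEdge e
      ... | paired i = neg-cancel (off _ p q) (off _ p' q')
        (trans (zeroB _ (clique-bnd {i} (inj₁ refl))) (sym (zeroB _ (clique-bnd {i} (inj₂ refl)))))
      ... | lifted e' = subst₂ (λ x y → x ≢ s → x ≢ t → y ≢ s → y ≢ t → Φ x ≡ Φ y)
        (sym (src-lift e')) (sym (tgt-lift e')) (constLift e') p q p' q'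

    -- The degenerate case `t = s`: as there are no loops, the neighbours of `s` avoid `t`.
    vertex-cut : ∀ {Φ Ψ s} → Mixed s → ConstX Φ → ConstY Ψ → (∀ x → Bnd N x → Ψ x ≡ 0ℚ) → VanishOffPair s s Φ Ψ →
      Φ s + Ψ s ≢ 0ℚ → Absurd
    vertex-cut {Φ} {Ψ} (_ , (e , e∈X , es) , (f , f∉X , fs)) constX constY zeroB off nz with otherEnd es | otherEnd fs
    ... | a , esa | c , fsc = pair-cut {Φ} {Ψ} constX constY zeroB off nz e∈X esa (joins-≢ esa)
      (lift-joins⁺ fsc) (joins-≢ fsc) (joins-≢ fsc) (sym (joins-const Ψ (constY f f∉X) fsc))

    -- An interior walk from an end of an edge in `X` to an end of an edge outside it switches sides
    -- at some vertex.
    mixed-exists : ∀ {e f} → suc e ∈ X → suc f ∉ X → ∃ Mixed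
    mixed-exists {e} {f} e∈X f∉X with interiorEnd e | interiorEnd f
    ... | x , ex , ix | y , fy , iy = walk-mixed {ok = Int N} step (proj₂ interior-connected x y ix iy) (e , e∈X , ex) (f , f∉X , fy)
      where
      step : ∀ g x y → Joins g x y → Int N x → Int N y → TouchY x ⊎ TouchX y
      step g x y gxy _ _ with suc g ∈? X
      ... | yes g∈X = inj₂ (g , g∈X , joins-incidentʳ gxy)
      ... | no g∉X  = inj₁ (g , g∉X , joins-incidentˡ gxy)

    record Decomposition {k} (f : Fin k → Fin (suc (n (Γ N))) → ℚ) : Set where
      field
        φ ψ        : Fin (suc (n (Γ N))) → ℚ
        α          : Fin k → ℚ
        constX     : ConstX (ext φ)
        constY     : ConstY (ext ψ)
        ψ₀≡0       : ψ zero ≡ 0ℚ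
        sum        : ∀ t → φ t + ψ t ≡ ∑ (λ i → α i * f i t)
        nontrivial : ∃ λ i → α i ≢ 0ℚ

      F : Fin (suc (n (Γ N))) → ℚ
      F t = ∑ (λ i → α i * f i t)

      sum-int : ∀ {x} → Int N x → ext φ x + ext ψ x ≡ F (suc x)
      sum-int {x} i = trans (ext-+ {φ} {ψ} {F} sum x) (ext-int F i)

      ψ-zero-on-B : ∀ x → Bnd N x → ext ψ x ≡ 0ℚ
      ψ-zero-on-B x b = trans (ext-bnd ψ b) (trans (cong (u x *_) ψ₀≡0) (ℚₚ.*-zeroʳ (u x)))

      φ₀≡F₀ : φ zero ≡ F zero
      φ₀≡F₀ = trans (sym (ℚₚ.+-identityʳ (φ zero))) (trans (cong (φ zero +_) (sym ψ₀≡0)) (sum zero))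

      φ-zero-on-B : F zero ≡ 0ℚ → ∀ x → Bnd N x → ext φ x ≡ 0ℚ
      φ-zero-on-B h x b = trans (ext-bnd φ b) (trans (cong (u x *_) (trans φ₀≡F₀ h)) (ℚₚ.*-zeroʳ (u x)))

      vanish-off : ∀ s t → F zero ≡ 0ℚ → (∀ x → x ≢ s → x ≢ t → F (suc x) ≡ 0ℚ) → VanishOffPair s t (ext φ) (ext ψ)
      vanish-off s t F₀ Fx x x≢s x≢t with bnd⊎int x
      ... | inj₁ b = trans (cong₂ _+_ (φ-zero-on-B F₀ x b) (ψ-zero-on-B x b)) (ℚₚ.+-identityˡ 0ℚ)
      ... | inj₂ i = trans (sum-int i) (Fx x x≢s x≢t)

      vertex-cut-at : ∀ {s} → Mixed s → F zero ≡ 0ℚ → (∀ x → x ≢ s → F (suc x) ≡ 0ℚ) → F (suc s) ≡ 0ℚ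
      vertex-cut-at {s} mixed F₀ Fx = decidable-stable (F (suc s) ℚₚ.≟ 0ℚ) λ nz →
        vertex-cut {ext φ} {ext ψ} mixed constX constY ψ-zero-on-B (vanish-off s s F₀ (λ x x≢s _ → Fx x x≢s))
          (λ h → nz (trans (sym (sum-int (proj₁ mixed))) h))

    decomposition : ∀ {k} → MatroidSeparation (DirichletIndep N u) k X → ∀ f → Decomposition {k} f
    decomposition sep f =
      let (φ , ψ , α , killsX , killsY , sum , nz) = decompose sep f in record
        { φ = φ ; ψ = ψ ; α = α ; constX = kills-edge {φ} killsX
        ; constY = λ e e∉X → kills-edge {ψ} killsY e (x∉p⇒x∈∁p e∉X)
        ; ψ₀≡0 = kills-e₀ {ψ} killsY (x∉p⇒x∈∁p e₀∉X) ; sum = sum ; nontrivial = nz }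

    ext-injective-on-B : ∀ φ → φ zero ≢ 0ℚ → ∀ {a b} → Bnd N a → Bnd N b → ext φ a ≡ ext φ b → a ≡ b
    ext-injective-on-B φ nz {a} {b} ba bb h = u-inj a b ba bb (difference-zero (*-nonzero nz (begin
      φ zero * (u a + (- u b))              ≡⟨ ℚsolve 3 (λ f x y → f :* (x :+ (:- y)) := x :* f :+ (:- (y :* f))) refl (φ zero) (u a) (u b) ⟩
      u a * φ zero + (- (u b * φ zero))     ≡⟨ cong₂ (λ x y → x + (- y)) (ext-bnd φ ba) (ext-bnd φ bb) ⟨
      ext φ a + (- ext φ b)                 ≡⟨ cong (λ x → x + (- ext φ b)) h ⟩
      ext φ b + (- ext φ b)                 ≡⟨ ℚₚ.+-inverseʳ (ext φ b) ⟩
      0ℚ                                    ∎)))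
      where open ≡-Reasoning

    unit-off : ∀ {s x : V} → x ≢ s → unit (suc s) (suc x) ≡ 0ℚ
    unit-off x≢s = unit-≢ (x≢s ∘ sym ∘ suc-injective)

    linear₁ : ∀ α {x y : ℚ} → x ≡ y → α * x + 0ℚ ≡ α * y
    linear₁ α refl = ℚₚ.+-identityʳ _

    -- With this single test function φ + ψ is concentrated at `s`, and its value there, the
    -- coefficient α, vanishes by `vertex-cut-at`.
    interior-functional : ∀ {s} → Mixed s → ¬ Decomposition {1} (λ _ → unit (suc s))
    interior-functional {s} mixed d with Decomposition.nontrivial d
    ... | zero , α≢0 = α≢0 (begin
      α zero         ≡⟨ ℚₚ.*-identityʳ (α zero) ⟨
      α zero * 1ℚ    ≡⟨ linear₁ (α zero) (unit-≡ (suc s)) ⟨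
      F (suc s)      ≡⟨ vertex-cut-at mixed (F≡0 {zero} λ ()) (λ x x≢s → F≡0 (x≢s ∘ sym ∘ suc-injective)) ⟩
      0ℚ             ∎)
      where
      open ≡-Reasoning
      open Decomposition d

      F≡0 : ∀ {t} → suc s ≢ t → F t ≡ 0ℚ
      F≡0 s≢t = trans (linear₁ (α zero) (unit-≢ s≢t)) (ℚₚ.*-zeroʳ (α zero))

    -- Here φ₀ is the nonzero coefficient, so the potential of φ is injective on `B`; but with every
    -- edge in `X` it is constant on the connected graph Γ.
    e₀-functional : (∀ e → suc e ∈ X) → ¬ Decomposition {1} (λ _ → unit zero)
    e₀-functional all d with Decomposition.nontrivial d
    ... | zero , α≢0 = b₁≢b₂ (ext-injective-on-B φ φ₀≢0 b₁-bnd b₂-bnd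
      (walk-invariant (ext φ) (λ e → constX e (all e)) (proj₂ Γ-connected b₁ b₂ _ _)))
      where
      open Decomposition d

      φ₀≢0 : φ zero ≢ 0ℚ
      φ₀≢0 h = α≢0 (trans (sym (trans (linear₁ (α zero) refl) (ℚₚ.*-identityʳ (α zero)))) (trans (sym φ₀≡F₀) h))

    no-1-separation : ¬ MatroidSeparation (DirichletIndep N u) 1 X
    no-1-separation sep with 1≤∣p∣⇒Nonempty {p = X} (proj₁ sep)
    ... | zero  , e∈X = e₀∉X e∈X
    ... | suc e , e∈X with any? (λ f → ¬? (suc f ∈? X))
    ...   | yes (f , f∉X) = let (s , mixed) = mixed-exists e∈X f∉X in interior-functional mixed (decomposition sep _)
    ...   | no none = e₀-functional (λ e → decidable-stable (suc e ∈? X) (λ e∉X → none (e , e∉X))) (decomposition sep _)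

    two : {A : Set} → A → A → Fin 2 → A
    two x y zero       = x
    two x y (suc zero) = y

    linear : ∀ α β {x y x' y' : ℚ} → x ≡ x' → y ≡ y' → α * x + (β * y + 0ℚ) ≡ α * x' + β * y'
    linear α β refl refl = cong (α * _ +_) (ℚₚ.+-identityʳ (β * _))

    linear-00 : ∀ α β {x y} → x ≡ 0ℚ → y ≡ 0ℚ → α * x + (β * y + 0ℚ) ≡ 0ℚ
    linear-00 α β p q = trans (linear α β p q) (ℚsolve 2 (λ a b → a :* con 0ℚ :+ b :* con 0ℚ := con 0ℚ) refl α β)

    linear-01 : ∀ α β {x y} → x ≡ 0ℚ → y ≡ 1ℚ → α * x + (β * y + 0ℚ) ≡ β
    linear-01 α β p q = trans (linear α β p q) (ℚsolve 2 (λ a b → a :* con 0ℚ :+ b :* con 1ℚ := b) refl α β)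

    β≡0-linear-0 : ∀ α {β x} y → β ≡ 0ℚ → x ≡ 0ℚ → α * x + (β * y + 0ℚ) ≡ 0ℚ
    β≡0-linear-0 α y refl p = trans (linear α 0ℚ {y = y} p refl) (ℚsolve 2 (λ a y → a :* con 0ℚ :+ con 0ℚ :* y := con 0ℚ) refl α y)

    β≡0-linear-1 : ∀ α {β x} y → β ≡ 0ℚ → x ≡ 1ℚ → α * x + (β * y + 0ℚ) ≡ α
    β≡0-linear-1 α y refl p = trans (linear α 0ℚ {y = y} p refl) (ℚsolve 2 (λ a y → a :* con 1ℚ :+ con 0ℚ :* y := a) refl α y)

    -- If the second coefficient vanished, φ + ψ would be concentrated at the mixed vertex `s`, and
    -- the first coefficient would vanish too by `vertex-cut-at`.
    β≢0 : ∀ {s} → Mixed s → ∀ {f₁} (d : Decomposition (two (unit (suc s)) f₁)) → Decomposition.α d (suc zero) ≢ 0ℚ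
    β≢0 {s} mixed {f₁} d β≡0 = nonzero nontrivial
      where
      open Decomposition d

      α₀≡0 : α zero ≡ 0ℚ
      α₀≡0 = trans (sym (β≡0-linear-1 (α zero) (f₁ (suc s)) β≡0 (unit-≡ (suc s))))
        (vertex-cut-at mixed (β≡0-linear-0 (α zero) (f₁ zero) β≡0 refl)
          (λ x x≢s → β≡0-linear-0 (α zero) (f₁ (suc x)) β≡0 (unit-off x≢s)))

      nonzero : ¬ ∃ λ i → α i ≢ 0ℚ
      nonzero (zero , nz)     = nz α₀≡0
      nonzero (suc zero , nz) = nz β≡0

    -- Such an X joins no two boundary nodes.
    Separating : (Fin (suc (n (Γ N))) → ℚ) → Set
    Separating φ = ConstX (ext φ) × φ zero ≢ 0ℚ

    e₀-separating : ∀ {s} → Mixed s → Decomposition (two (unit (suc s)) (unit zero)) → ∃ Separating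
    e₀-separating mixed d = φ , constX ,
      λ φ₀≡0 → β≢0 mixed d (trans (sym (linear-01 (α zero) (α (suc zero)) refl refl)) (trans (sym φ₀≡F₀) φ₀≡0))
      where open Decomposition d

    module _ (sep : MatroidSeparation (DirichletIndep N u) 2 X) where

      -- Otherwise `j` and `t` would cut Γ̂. The test functions are the indicator of `t` and a
      -- function `J` constant along `X`. Subtracting β J from φ keeps it constant along `X`; its
      -- sum with ψ then vanishes off `j` and `t` and equals -β at `j`.
      boundary-cut : ∃ Separating → ∀ {t j e a} → Mixed t → Bnd N j → suc e ∈ X → Joins e j a → a ≡ t
      boundary-cut (φ₁ , constX₁ , nz₁) {t} {j} {e} {a} mixed@(it , _) bj e∈X eja = decidable-stable (a ≟ t) (cut (decomposition sep _))
        where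
        -- Equals the indicator of j on B, which replaces u there: this puts j in the role of an interior vertex.
        J : V → ℚ
        J x = if isYes (ext φ₁ x ℚₚ.≟ ext φ₁ j) then 1ℚ else 0ℚ

        J-j : J j ≡ 1ℚ
        J-j = cong (if_then 1ℚ else 0ℚ) (isYes⁺ (ext φ₁ j ℚₚ.≟ ext φ₁ j) refl)

        J-≢ : ∀ {x} → Bnd N x → x ≢ j → J x ≡ 0ℚ
        J-≢ {x} b x≢j with ext φ₁ x ℚₚ.≟ ext φ₁ j
        ... | yes p = contradiction (ext-injective-on-B φ₁ nz₁ b bj p) x≢j
        ... | no _  = refl

        J-const : ConstX J
        J-const e e∈X = cong (λ y → if isYes (y ℚₚ.≟ ext φ₁ j) then 1ℚ else 0ℚ) (constX₁ e e∈X)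

        -- The e₀-coordinate 0 forces φ₀ = 0, so the potential of φ vanishes on `B`.
        f₁ : Fin (suc (n (Γ N))) → ℚ
        f₁ zero    = 0ℚ
        f₁ (suc x) = J x

        cut : Decomposition (two (unit (suc t)) f₁) → ¬ a ≢ t
        cut d a≢t =
          -- Another boundary node serves as the second neighbour of `j`: a clique edge joins the
          -- two, and ψ vanishes at both.
          pair-cut {Φ} {ext ψ} {j} {t} Φ-const constY ψ-zero-on-B off at-j e∈X eja a≢t
            (proj₂ (clique-edge bj (proj₁ (proj₂ (otherBnd j))) (proj₂ (proj₂ (otherBnd j)) ∘ sym)))
            (proj₂ (proj₂ (otherBnd j))) (bnd-≢-int (proj₁ (proj₂ (otherBnd j))) it)
            (trans (ψ-zero-on-B _ (proj₁ (proj₂ (otherBnd j)))) (sym (ψ-zero-on-B j bj)))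
          where
          open ≡-Reasoning
          open Decomposition d

          β : ℚ
          β = α (suc zero)

          Φ : V → ℚ
          Φ x = ext φ x + (- (β * J x))

          φ-B : ∀ x → Bnd N x → ext φ x ≡ 0ℚ
          φ-B = φ-zero-on-B (linear-00 (α zero) β refl refl)

          Φ-const : ConstX Φ
          Φ-const e e∈X = cong₂ (λ x y → x + (- (β * y))) (constX e e∈X) (J-const e e∈X)

          off : VanishOffPair j t Φ (ext ψ)
          off x x≢j x≢t with bnd⊎int x
          ... | inj₁ b = begin
            ext φ x + (- (β * J x)) + ext ψ x    ≡⟨ cong₂ _+_ (cong₂ (λ y z → y + (- (β * z))) (φ-B x b) (J-≢ b x≢j)) (ψ-zero-on-B x b) ⟩
            0ℚ + (- (β * 0ℚ)) + 0ℚ               ≡⟨ ℚsolve 1 (λ b → con 0ℚ :+ (:- (b :* con 0ℚ)) :+ con 0ℚ := con 0ℚ) refl β ⟩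
            0ℚ                                   ∎
          ... | inj₂ i = begin
            ext φ x + (- (β * J x)) + ext ψ x    ≡⟨ ℚsolve 3 (λ x y z → x :+ (:- y) :+ z := x :+ z :+ (:- y)) refl (ext φ x) (β * J x) (ext ψ x) ⟩
            ext φ x + ext ψ x + (- (β * J x))    ≡⟨ cong (_+ (- (β * J x))) (trans (sum-int i) (linear (α zero) β (unit-off x≢t) refl)) ⟩
            α zero * 0ℚ + β * J x + (- (β * J x))     ≡⟨ ℚsolve 2 (λ a y → a :* con 0ℚ :+ y :+ (:- y) := con 0ℚ) refl (α zero) (β * J x) ⟩
            0ℚ                                   ∎

          at-j : Φ j + ext ψ j ≢ 0ℚ
          at-j h = β≢0 mixed d (ℚₚ.neg-injective (begin
            - β                                  ≡⟨ ℚsolve 1 (λ b → :- b := con 0ℚ :+ (:- (b :* con 1ℚ)) :+ con 0ℚ) refl β ⟩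
            0ℚ + (- (β * 1ℚ)) + 0ℚ               ≡⟨ cong₂ _+_ (cong₂ (λ y z → y + (- (β * z))) (φ-B j bj) J-j) (ψ-zero-on-B j bj) ⟨
            Φ j + ext ψ j                        ≡⟨ h ⟩
            0ℚ                                   ∎))

      -- Testing with `q` and `p` concentrates φ + ψ on these two vertices; at `p` it equals β,
      -- which is nonzero because `q` is mixed.
      interior-cut : ∀ {p q e a f c} → Mixed p → Mixed q → q ≢ p → suc e ∈ X → Joins e p a → a ≢ q →
        suc f ∉ X → Joins f p c → c ≢ q → Absurd
      interior-cut {p} {q} {e} {a} {f} {c} mp mq q≢p e∈X epa a≢q f∉X fpc c≢q = cut (decomposition sep _)
        where
        cut : ¬ Decomposition (two (unit (suc q)) (unit (suc p)))
        cut d = pair-cut {ext φ} {ext ψ} {p} {q} constX constY ψ-zero-on-B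
          (vanish-off p q (linear-00 (α zero) β refl refl) (λ x x≢p x≢q → linear-00 (α zero) β (unit-off x≢q) (unit-off x≢p)))
          (λ h → β≢0 mq d (trans (sym (trans (sum-int (proj₁ mp)) (linear-01 (α zero) β (unit-off (q≢p ∘ sym)) (unit-≡ (suc p))))) h))
          e∈X epa a≢q (lift-joins⁺ fpc) (joins-≢ fpc) c≢q (sym (joins-const (ext ψ) (constY f f∉X) fpc))
          where
          open Decomposition d

          β : ℚ
          β = α (suc zero)

      -- Let `c` be the other end of `f'` at `t`, and `a` that of `e'` at `r`. If `c` is not `r`,
      -- then `t` and `r` form a cut; if `c` is `r` but `a` is not `s`, then `r` and `s` do;
      -- otherwise `e'` and `f` would be parallel edges on different sides.
      triangle-cut : ∀ {s t r e f} → Mixed s → Mixed t → Mixed r → t ≢ s → r ≢ s → r ≢ t →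
        suc e ∈ X → Joins e s t → suc f ∉ X → Joins f s r → Absurd
      triangle-cut {s} {t} {r} {e} {f} ms mt@(_ , _ , (f' , f'∉X , f't)) mr@(_ , (e' , e'∈X , e'r) , _) t≢s r≢s r≢t e∈X est f∉X fsr
        with otherEnd f't | otherEnd e'r
      ... | c , f'tc | a , e'ra with c ≟ r | a ≟ s
      ...   | no c≢r   | _        = interior-cut mt mr r≢t e∈X (joins-sym est) (r≢s ∘ sym) f'∉X f'tc c≢r
      ...   | yes refl | no a≢s   = interior-cut mr ms (r≢s ∘ sym) e'∈X e'ra a≢s f'∉X (joins-sym f'tc) t≢s
      ...   | yes refl | yes refl = f∉X (subst (λ g → suc g ∈ X) (joins-unique (joins-sym e'ra) fsr) e'∈X)

      -- As Γ has no parallel edges, one of three mixed vertices has an X-neighbour and a Y-neighbour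
      -- that both differ from another one.
      three-mixed : ∀ {s t r} → Mixed s → Mixed t → Mixed r → t ≢ s → r ≢ s → r ≢ t → Absurd
      three-mixed {s} {t} {r} ms@(_ , (e , e∈X , es) , (f , f∉X , fs)) mt mr t≢s r≢s r≢t with otherEnd es | otherEnd fs
      ... | a , esa | c , fsc with a ≟ t | c ≟ t | a ≟ r | c ≟ r
      ...   | no a≢t   | no c≢t   | _        | _        = interior-cut ms mt t≢s e∈X esa a≢t f∉X fsc c≢t
      ...   | _        | _        | no a≢r   | no c≢r   = interior-cut ms mr r≢s e∈X esa a≢r f∉X fsc c≢r
      ...   | yes refl | _        | yes refl | _        = r≢t refl
      ...   | _        | yes refl | _        | yes refl = r≢t refl
      ...   | yes refl | _        | _        | yes refl = triangle-cut ms mt mr t≢s r≢s r≢t e∈X esa f∉X fsc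
      ...   | _        | yes refl | yes refl | _        = triangle-cut ms mr mt r≢s t≢s (r≢t ∘ sym) e∈X esa f∉X fsc

      -- The lift of `X` to Γ̂: the clique edges take the place of e₀ outside it.
      module _ (hatX : Subset (m (hatΓ N))) (lift∈ : ∀ {e} → suc e ∈ X → lift e ∈ hatX)
        (lift∉ : ∀ {e} → suc e ∉ X → lift e ∉ hatX) (clique∉ : ∀ {i} → clique i ∉ hatX) where

        S : Subset (n (hatΓ N))
        S = sharedVerts (hatΓ N) hatX

        S-touchX : ∀ {x} → x ∈ S → TouchX x
        S-touchX {x} x∈S = touch (proj₁ (H.∈-shared⁻ {hatX} x∈S))
          where
          touch : (∃ λ e → e ∈ hatX × H.Incident e x) → TouchX x
          touch (e , e∈ , ex) with hatEdge e
          ... | paired i  = contradiction e∈ clique∉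
          ... | lifted e' = e' , decidable-stable (suc e' ∈? X) (λ e'∉X → lift∉ e'∉X e∈) , lift-incident⁻ ex

        S-mixed : ∀ {x} → x ∈ S → Int N x → Mixed x
        S-mixed {x} x∈S ix = touch (proj₂ (H.∈-shared⁻ {hatX} x∈S))
          where
          touch : (∃ λ f → f ∉ hatX × H.Incident f x) → Mixed x
          touch (f , f∉ , fx) with hatEdge f
          ... | lifted f' = ix , S-touchX x∈S , f' , (λ f'∈X → f∉ (lift∈ f'∈X)) , lift-incident⁻ fx
          ... | paired i  = ⊥-elim (bnd-int (clique-bnd {i} fx) ix)

        s∈S : ∀ {s} → Mixed s → s ∈ S
        s∈S (_ , (g , g∈X , gs) , (h , h∉X , hs)) =
          H.∈-shared⁺ (lift∈ g∈X) (lift-incident⁺ gs) (lift∉ h∉X) (lift-incident⁺ hs)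

        -- By `boundary-cut` an `X`-neighbour of a boundary node equals every mixed vertex, so a
        -- shared boundary node leaves room for only one mixed vertex.
        boundary-neighbour : ∃ Separating → ∀ {j} → Bnd N j → TouchX j → ∃ λ a → ∀ {t} → Mixed t → a ≡ t
        boundary-neighbour separating bj (e , e∈X , ej) =
          let (a , eja) = otherEnd ej in a , λ mt → boundary-cut separating mt bj e∈X eja

        boundary-value : ∀ φ {s} → Separating φ → Mixed s → ∀ {j} → Bnd N j → TouchX j → ext φ j ≡ ext φ s
        boundary-value φ (constX , nz) ms bj (e , e∈X , ej) =
          let (a , eja) = otherEnd ej
          in trans (joins-const (ext φ) (constX e e∈X) eja) (cong (ext φ) (boundary-cut (φ , constX , nz) ms bj e∈X eja))

        -- Two further interior vertices contradict `three-mixed`; one of each kind contradicts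
        -- `boundary-neighbour`; two boundary nodes both have `s` as an `X`-neighbour, so φ agrees
        -- on them although it is injective on `B`.
        three-shared : ∃ Separating → ∀ {s x y} → Mixed s → x ∈ S → y ∈ S → x ≢ s → y ≢ s → y ≢ x → Absurd
        three-shared sp@(φ , sφ) {s} {x} {y} ms x∈S y∈S x≢s y≢s y≢x with bnd⊎int x | bnd⊎int y
        ... | inj₂ ix | inj₂ iy = three-mixed ms (S-mixed x∈S ix) (S-mixed y∈S iy) x≢s y≢s y≢x
        ... | inj₁ bx | inj₂ iy = let (_ , only) = boundary-neighbour sp bx (S-touchX x∈S)
          in y≢s (trans (sym (only (S-mixed y∈S iy))) (only ms))
        ... | inj₂ ix | inj₁ by = let (_ , only) = boundary-neighbour sp by (S-touchX y∈S)
          in x≢s (trans (sym (only (S-mixed x∈S ix))) (only ms))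
        ... | inj₁ bx | inj₁ by = y≢x (sym (ext-injective-on-B φ (proj₂ sφ) bx by
          (trans (boundary-value φ sφ ms bx (S-touchX x∈S)) (sym (boundary-value φ sφ ms by (S-touchX y∈S))))))

        no-2-separation-hat : Absurd
        no-2-separation-hat with 1≤∣p∣⇒Nonempty {p = X} (ℕₚ.≤-trans (s≤s z≤n) (proj₁ sep))
          | 2≤∣p∣⇒other {p = ∁ X} (proj₁ (proj₂ sep)) (x∉p⇒x∈∁p e₀∉X)
        ... | zero , e∈X | _ = e₀∉X e∈X
        ... | _ | zero , _ , z≢z = z≢z refl
        ... | suc e , e∈X | suc f , f∈∁X , _ with 2≤∣p∣⇒other {p = X} (proj₁ sep) e∈X
        ...   | zero , e'∈X , _ = e₀∉X e'∈X
        ...   | suc e' , e'∈X , e'≢e = count (mixed-exists e∈X (x∈∁p⇒x∉p f∈∁X))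
          where
          f∉ : lift f ∈ ∁ hatX
          f∉ = x∉p⇒x∈∁p (lift∉ (x∈∁p⇒x∉p f∈∁X))

          count : ¬ ∃ Mixed
          count (s , ms@(is , (g , g∈X , gs) , (h , h∉X , hs))) with any? (λ x → (x ∈? S) ×-dec ¬? (x ≟ s))
          ... | no only = proj₂ hat-3-connected 1 hatX (s≤s z≤n) (s≤s (s≤s z≤n))
            ( 1≤∣p∣ (lift∈ e∈X) , 1≤∣p∣ f∉
            , ∣p∣≡1 (s∈S ms) (λ y y∈ → decidable-stable (y ≟ s) (λ y≢s → only (y , y∈ , y≢s))))
          ... | yes (x , x∈S , x≢s) with any? (λ y → (y ∈? S) ×-dec ¬? (y ≟ s) ×-dec ¬? (y ≟ x))
          ...   | yes (y , y∈S , y≢s , y≢x) = three-shared (e₀-separating ms (decomposition sep _)) ms x∈S y∈S x≢s y≢s y≢x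
          -- The clique edge between `b₁` and `b₂` is the second edge outside `hatX`, standing in
          -- for e₀.
          ...   | no only = proj₂ hat-3-connected 2 hatX (s≤s z≤n) (s≤s (s≤s (s≤s z≤n)))
            ( 2≤∣p∣ (lift∈ e∈X) (lift∈ e'∈X) (λ p → e'≢e (cong suc (↑ˡ-injective ℓ e' e p)))
            , 2≤∣p∣ f∉ (x∉p⇒x∈∁p (clique∉ {proj₁ (clique-edge b₁-bnd b₂-bnd b₁≢b₂)})) (lift≢clique ∘ sym)
            , ∣p∣≡2 (s∈S ms) x∈S x≢s only-two)
            where
            only-two : ∀ y → y ∈ S → y ≡ s ⊎ y ≡ x
            only-two y y∈S with y ≟ s | y ≟ x
            ... | yes p | _     = inj₁ p
            ... | no _  | yes p = inj₂ p
            ... | no p  | no q  = contradiction (y , y∈S , p , q) only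

      InX : H.E → Set
      InX e = ∃ λ e' → e ≡ lift e' × suc e' ∈ X

      inX? : ∀ e → Dec (InX e)
      inX? e = any? (λ e' → (e ≟ lift e') ×-dec (suc e' ∈? X))

      hatX : Subset (m (hatΓ N))
      hatX = comprehension inX?

      lift∈ : ∀ {e} → suc e ∈ X → lift e ∈ hatX
      lift∈ e∈X = ∈-comprehension⁺ inX? (_ , refl , e∈X)

      lift∉ : ∀ {e} → suc e ∉ X → lift e ∉ hatX
      lift∉ {e} e∉X h with ∈-comprehension⁻ inX? h
      ... | e' , p , e'∈X = e∉X (subst (λ g → suc g ∈ X) (sym (↑ˡ-injective ℓ e e' p)) e'∈X)

      clique∉ : ∀ {i} → clique i ∉ hatX
      clique∉ h with ∈-comprehension⁻ inX? h
      ... | _ , p , _ = lift≢clique (sym p)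

      no-2-separation : Absurd
      no-2-separation = no-2-separation-hat hatX lift∈ lift∉ clique∉

  matroid-separation-∁ : ∀ {k X} → MatroidSeparation (DirichletIndep N u) k X → MatroidSeparation (DirichletIndep N u) k (∁ X)
  matroid-separation-∁ {k} {X} (hX , hY , a , b , c , rX , rY , rM , lt) =
    hY , subst (λ Z → k ≤ ∣ Z ∣) (sym (∁-involutive X)) hX , b , a , c , rY ,
    subst (λ Z → IsRank (DirichletIndep N u) Z a) (sym (∁-involutive X)) rX , rM , subst (_< c +ₙ k) (ℕₚ.+-comm a b) lt

  no-separation : ∀ k X → 1 ≤ k → k < 3 → zero ∉ X → ¬ MatroidSeparation (DirichletIndep N u) k X
  no-separation 1 X _ _ e₀∉X sep = Side.no-1-separation X e₀∉X sep
  no-separation 2 X _ _ e₀∉X sep = Side.no-2-separation X e₀∉X sep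
  no-separation (suc (suc (suc _))) X _ (s≤s (s≤s (s≤s ()))) _ _

  matroid-3-connected : Matroid3Connected (DirichletIndep N u)
  matroid-3-connected k X 1≤k k<3 sep with zero ∈? X
  ... | no e₀∉X  = no-separation k X 1≤k k<3 e₀∉X sep
  ... | yes e₀∈X = no-separation k (∁ X) 1≤k k<3 (x∈p⇒x∉∁p e₀∈X) (matroid-separation-∁ sep)

-- From the matroid to the graph

module Necessity (N : Network) (net : IsNetwork N) (u : Fin (n (Γ N)) → ℚ) (u-inj : InjectiveOnB N u)
  (matroid-connected : Matroid3Connected (DirichletIndep N u)) where

  open NetworkLemmas N net u u-inj

  Functional : Set
  Functional = Fin (suc (n (Γ N))) → ℚ

  Annihilates : Subset (suc (m (Γ N))) → Functional → Set
  Annihilates X p = ∀ φ → Kills φ X → φ · p ≡ 0ℚ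

  -- The potential of this functional is the indicator of `x` if `x` is interior, and zero if `x` is
  -- a boundary node, whose coordinate `ext` ignores.
  coordinate-kills : ∀ x {Z} → (Int N x → ∀ e → suc e ∈ Z → ¬ Incident e x) → Kills (unit (suc x)) Z
  coordinate-kills x {Z} untouched = kills⁺ {unit (suc x)} {Z} (λ _ → refl)
    (λ e e∈Z → trans (ext≡0 (inj₁ refl) e∈Z) (sym (ext≡0 (inj₂ refl) e∈Z)))
    where
    ext≡0 : ∀ {e y} → Incident e y → suc e ∈ Z → ext (unit (suc x)) y ≡ 0ℚ
    ext≡0 {e} {y} ey e∈Z with bnd⊎int y
    ... | inj₁ b = trans (ext-bnd (unit (suc x)) b) (ℚₚ.*-zeroʳ (u y))
    ... | inj₂ i = trans (ext-int (unit (suc x)) i) (unit-≢ (λ p → untouched′ (sym (suc-injective p))))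
      where
      untouched′ : ¬ y ≡ x
      untouched′ refl = untouched i e e∈Z ey

  coordinate-zero : ∀ {X p} → Annihilates X p → ∀ x → (Int N x → ∀ e → suc e ∈ X → ¬ Incident e x) → p (suc x) ≡ 0ℚ
  coordinate-zero {X} {p} ann x untouched = trans (sym (unit-· (suc x) p)) (ann (unit (suc x)) (coordinate-kills x {X} untouched))

  all-zero : ∀ {X p} → Annihilates X p → p zero ≡ 0ℚ → (∀ x → Int N x → p (suc x) ≡ 0ℚ) → ∀ t → p t ≡ 0ℚ
  all-zero             ann p₀ pI zero    = p₀
  all-zero {X} {p} ann p₀ pI (suc x) with bnd⊎int x
  ... | inj₁ b = coordinate-zero {X} {p} ann x (λ i → ⊥-elim (bnd-int b i))
  ... | inj₂ i = pI x i

  -- A vector of span X supported on one vertex r and on e₀ vanishes if X meets B in at most r: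
  -- the potential constant on X with value u r (or 0 and 1) detects it.
  residual-zero : ∀ {X p} r → zero ∉ X → (∀ {e x} → suc e ∈ X → Incident e x → Bnd N x → x ≡ r) → Annihilates X p →
    (∀ x → Int N x → x ≢ r → p (suc x) ≡ 0ℚ) → ∀ t → p t ≡ 0ℚ
  residual-zero {X} {p} r e₀∉X onlyB ann pI with bnd⊎int r
  ... | inj₁ rB = all-zero {X} {p} ann p₀≡0 pI′
    where
    pI′ : ∀ x → Int N x → p (suc x) ≡ 0ℚ
    pI′ x i = pI x i (bnd-≢-int rB i ∘ sym)

    φ : Functional
    φ zero    = 1ℚ
    φ (suc _) = u r

    ext≡ur : ∀ {e x} → suc e ∈ X → Incident e x → ext φ x ≡ u r
    ext≡ur {e} {x} e∈X ex with bnd⊎int x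
    ... | inj₁ b = trans (ext-bnd φ b) (trans (ℚₚ.*-identityʳ (u x)) (cong u (onlyB e∈X ex b)))
    ... | inj₂ i = ext-int φ i

    p-suc : ∀ x → p (suc x) ≡ 0ℚ
    p-suc x with bnd⊎int x
    ... | inj₁ b = coordinate-zero {X} {p} ann x (λ i → ⊥-elim (bnd-int b i))
    ... | inj₂ i = pI′ x i

    off : ∀ t → t ≢ zero → φ t * p t ≡ 0ℚ
    off zero    0≢0 = contradiction refl 0≢0
    off (suc x) _   = trans (cong (u r *_) (p-suc x)) (ℚₚ.*-zeroʳ (u r))

    p₀≡0 : p zero ≡ 0ℚ
    p₀≡0 = trans (sym (trans (∑-single zero (λ t → φ t * p t) off) (ℚₚ.*-identityˡ (p zero))))
      (ann φ (kills⁺ {φ} {X} (λ e₀∈X → contradiction e₀∈X e₀∉X) (λ e e∈X → trans (ext≡ur e∈X (inj₁ refl)) (sym (ext≡ur e∈X (inj₂ refl))))))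
  ... | inj₂ rI = all-zero {X} {p} ann p₀≡0 pI′
    where
    interior : ∀ {e x} → suc e ∈ X → Incident e x → Int N x
    interior {e} {x} e∈X ex with bnd⊎int x
    ... | inj₁ b = ⊥-elim (bnd-≢-int b rI (onlyB e∈X ex b))
    ... | inj₂ i = i

    -- With `r` interior, `X` meets no boundary node, so φ₀ is unconstrained.
    kills-const : ∀ φ c → (∀ x → φ (suc x) ≡ c) → Kills φ X
    kills-const φ c h = kills⁺ {φ} {X} (λ e₀∈X → contradiction e₀∈X e₀∉X) (λ e e∈X → trans (value e∈X (inj₁ refl)) (sym (value e∈X (inj₂ refl))))
      where
      value : ∀ {e x} → suc e ∈ X → Incident e x → ext φ x ≡ c
      value e∈X ex = trans (ext-int φ (interior e∈X ex)) (h _)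

    p₀≡0 : p zero ≡ 0ℚ
    p₀≡0 = trans (sym (unit-· zero p)) (ann (unit zero) (kills-const (unit zero) 0ℚ (λ _ → refl)))

    one : Functional
    one zero    = 0ℚ
    one (suc _) = 1ℚ

    off : ∀ t → t ≢ suc r → one t * p t ≡ 0ℚ
    off zero    _ = ℚₚ.*-zeroˡ (p zero)
    off (suc x) x≢r with bnd⊎int x
    ... | inj₁ b = trans (ℚₚ.*-identityˡ (p (suc x))) (coordinate-zero {X} {p} ann x (λ i → ⊥-elim (bnd-int b i)))
    ... | inj₂ i = trans (ℚₚ.*-identityˡ (p (suc x))) (pI x i (x≢r ∘ cong suc))

    pr≡0 : p (suc r) ≡ 0ℚ
    pr≡0 = trans (sym (trans (∑-single (suc r) (λ t → one t * p t) off) (ℚₚ.*-identityˡ (p (suc r)))))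
      (ann one (kills-const one 1ℚ (λ _ → refl)))

    pI′ : ∀ x → Int N x → p (suc x) ≡ 0ℚ
    pI′ x i with x ≟ r
    ... | yes refl = pr≡0
    ... | no x≢r   = pI x i x≢r

  -- Components of the interior graph

  module Component (a : V) (ia : Int N a) where

    int? : ∀ x → Dec (Int N x)
    int? x with bnd⊎int x
    ... | inj₁ b = no (bnd-int b)
    ... | inj₂ i = yes i

    open Reachability int?

    edges : List E
    edges = List.allFin (m (Γ N))

    InK : V → Set
    InK x = Int N x × Reach edges a x

    inK? : ∀ x → Dec (InK x)
    inK? x = int? x ×-dec reach? edges a x

    K-closed : ∀ {e x y} → Joins e x y → InK x → Int N y → InK y
    K-closed {e} exy (ix , ax) iy = iy , reach-trans edges ax (reach-edge edges (Lₚ.∈-allFin e) exy ix iy)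

    Touches : Fin (suc (m (Γ N))) → Set
    Touches zero    = Absurd
    Touches (suc e) = ∃ λ x → Incident e x × InK x

    touches? : ∀ k → Dec (Touches k)
    touches? zero    = no λ ()
    touches? (suc e) = any? (λ x → incident? e x ×-dec inK? x)

    not-touching : ∀ {e x} → Incident e x → Int N x → ¬ InK x → ¬ Touches (suc e)
    not-touching {e} {x} ex ix ¬Kx (y , ey , Ky) =
      let (z , eyz) = otherEnd ey
      in [ (λ { refl → ¬Kx Ky }) , (λ { refl → ¬Kx (K-closed eyz Ky ix) }) ]′ (joins-ends eyz ex)

    module _ (X : Subset (suc (m (Γ N)))) (∈X⁺ : ∀ {k} → Touches k → k ∈ X) (∈X⁻ : ∀ {k} → k ∈ X → Touches k) where

      -- The edges at an interior vertex all lie in `X` or all outside it, according to whether the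
      -- vertex is in the component; its coordinate functional kills the side that it misses.
      interior-zero : ∀ {p} → Annihilates X p → Annihilates (∁ X) p → ∀ x → Int N x → p (suc x) ≡ 0ℚ
      interior-zero {p} annX annY x ix with inK? x
      ... | yes Kx = coordinate-zero {∁ X} {p} annY x (λ _ e e∈ ex → x∈∁p⇒x∉p e∈ (∈X⁺ (x , ex , Kx)))
      ... | no ¬Kx = coordinate-zero {X} {p} annX x (λ _ e e∈ ex → not-touching ex ix ¬Kx (∈X⁻ e∈))

      -- A vertex `w` outside the component puts an edge beside e₀ outside `X`. The spans meet at
      -- most in the e₀-axis, so `X` is a 2-separation if it has two elements. If it is a single
      -- edge, it meets `B` at most in the end other than `a`; then the spans meet in zero and `X`
      -- is a 1-separation.
      component-full : ∀ w → Int N w → ¬ ¬ InK w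
      component-full w iw ¬Kw = split (edgeAt a) (edgeAt w)
        where
        e₀∉X : zero ∉ X
        e₀∉X h = ∈X⁻ h

        split : (∃ λ e → Incident e a) → (∃ λ f → Incident f w) → Absurd
        split (e , ea) (f , fw) with any? (λ e' → (suc e' ∈? X) ×-dec ¬? (e' ≟ e))
        ... | yes (e' , e'∈X , e'≢e) = span-intersection {1} {X} (s≤s (s≤s (s≤s z≤n)))
            (2≤∣p∣ (∈X⁺ {suc e} (a , ea , ia , reach-refl edges)) e'∈X (e'≢e ∘ suc-injective))
            (2≤∣p∣ (x∉p⇒x∈∁p e₀∉X) (x∉p⇒x∈∁p (λ f∈X → not-touching fw iw ¬Kw (∈X⁻ f∈X))) λ ())
            (unit zero ∷ []) trivial matroid-connected
          where
          trivial : ∀ p → Annihilates X p → Annihilates (∁ X) p → All (λ l → l · p ≡ 0ℚ) (unit zero ∷ []) → ∀ t → p t ≡ 0ℚ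
          trivial p annX annY (p₀ ∷ []) = all-zero {X} {p} annX (trans (sym (unit-· zero p)) p₀) (interior-zero {p} annX annY)
        ... | no single = span-intersection {0} {X} (s≤s (s≤s z≤n))
            (1≤∣p∣ (∈X⁺ {suc e} (a , ea , ia , reach-refl edges))) (1≤∣p∣ (x∉p⇒x∈∁p e₀∉X)) [] trivial matroid-connected
          where
          z : V
          z = proj₁ (otherEnd ea)

          onlyB : ∀ {e' x} → suc e' ∈ X → Incident e' x → Bnd N x → x ≡ z
          onlyB {e'} {x} e'∈X e'x b with e' ≟ e
          ... | no e'≢e  = contradiction (e' , e'∈X , e'≢e) single
          ... | yes refl with joins-ends (proj₂ (otherEnd ea)) e'x
          ...   | inj₁ refl = ⊥-elim (bnd-int b ia)
          ...   | inj₂ x≡z  = x≡z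

          trivial : ∀ p → Annihilates X p → Annihilates (∁ X) p → All (λ l → l · p ≡ 0ℚ) [] → ∀ t → p t ≡ 0ℚ
          trivial p annX annY [] = residual-zero {X} {p} z e₀∉X onlyB annX (λ x i _ → interior-zero {p} annX annY x i)

    interior-walk : ∀ w → Int N w → Walk (Γ N) (Int N) a w
    interior-walk w iw = reach⇒walk edges ia (proj₂ (decidable-stable (inK? w)
      (component-full (comprehension touches?) (∈-comprehension⁺ touches?) (∈-comprehension⁻ touches?) w iw)))

  interior-connected : InteriorConnected N
  interior-connected = (i₀ , i₀-int) , λ a w ia iw → Component.interior-walk a ia w iw

  -- Separations of Γ̂

  module HatSeparation {k} (Z : Subset (m (hatΓ N))) (k<3 : k < 3) (sep : GraphSeparation (hatΓ N) k Z) where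

    S : Subset (n (hatΓ N))
    S = sharedVerts (hatΓ N) Z

    ∣S∣≡k : ∣ S ∣ ≡ k
    ∣S∣≡k = proj₂ (proj₂ sep)

    not-three : ∀ {x y z} → x ∈ S → y ∈ S → z ∈ S → y ≢ x → z ≢ x → z ≢ y → Absurd
    not-three hx hy hz p q r = ℕₚ.<⇒≱ k<3 (subst (3 ≤_) ∣S∣≡k (3≤∣p∣ hx hy hz p q r))

    -- Otherwise `∁ Z` consists of clique edges, whose ends also lie on edges of Γ and are thus
    -- shared. One clique edge gives two shared vertices, two give three by `clique-third`: in
    -- either case more than `k`.
    not-all-in-Z : 1 ≤ k → ¬ (∀ e → lift e ∈ Z)
    not-all-in-Z 1≤k all with 1≤∣p∣⇒Nonempty {p = ∁ Z} (ℕₚ.≤-trans 1≤k (proj₁ (proj₂ sep)))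
    ... | g , g∈ with hatEdge g
    ...   | lifted e = x∈∁p⇒x∉p g∈ (all e)
    ...   | paired i with 2 ℕₚ.≤? k
    ...     | no k<2 = k<2 (subst (2 ≤_) ∣S∣≡k (2≤∣p∣ (∈S (H.joins-incidentˡ (clique-joins i))) (∈S (H.joins-incidentʳ (clique-joins i))) (clique-≢ i)))
      where
      ∈S : ∀ {x} → H.Incident (clique i) x → x ∈ S
      ∈S ix = H.∈-shared⁺ (all _) (lift-incident⁺ (proj₂ (edgeAt _))) (x∈∁p⇒x∉p g∈) ix
    ...     | yes 2≤k with 2≤∣p∣⇒other {p = ∁ Z} (ℕₚ.≤-trans 2≤k (proj₁ (proj₂ sep))) g∈
    ...       | h , h∈ , h≢g with hatEdge h
    ...         | lifted e = x∈∁p⇒x∉p h∈ (all e)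
    ...         | paired j with clique-third {i} {j} (λ { refl → h≢g refl })
    ...           | z , jz , z≢a , z≢b = not-three
      (∈S g∈ (H.joins-incidentˡ (clique-joins i))) (∈S g∈ (H.joins-incidentʳ (clique-joins i))) (∈S h∈ jz) (clique-≢ i) z≢a z≢b
      where
      ∈S : ∀ {i x} → clique i ∈ ∁ Z → H.Incident (clique i) x → x ∈ S
      ∈S i∈ ix = H.∈-shared⁺ (all _) (lift-incident⁺ (proj₂ (edgeAt _))) (x∈∁p⇒x∉p i∈) ix

    -- The walk argument of `mixed-exists`, with the interior connectivity already derived from the
    -- matroid.
    mixed-interior : ∀ {e f} → lift e ∈ Z → lift f ∉ Z → ∃ λ s → Int N s × s ∈ S
    mixed-interior {e} {f} e∈Z f∉Z =
      let (x , ex , ix) = interiorEnd e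
          (y , fy , iy) = interiorEnd f
          (s , is , (g , g∈ , gs) , (h , h∉ , hs)) =
            walk-mixed {ok = Int N} step (proj₂ interior-connected x y ix iy) (e , e∈Z , ex) (f , f∉Z , fy)
      in s , is , H.∈-shared⁺ g∈ (lift-incident⁺ gs) h∉ (lift-incident⁺ hs)
      where
      step : ∀ g x y → Joins g x y → Int N x → Int N y →
        (∃ λ h → lift h ∉ Z × Incident h x) ⊎ (∃ λ h → lift h ∈ Z × Incident h y)
      step g x y gxy _ _ with lift g ∈? Z
      ... | yes g∈ = inj₂ (g , g∈ , joins-incidentʳ gxy)
      ... | no g∉  = inj₁ (g , g∉ , joins-incidentˡ gxy)

    -- `S` has at most two elements, one of them interior, so it cannot contain both ends of a
    -- clique edge.
    pure-end : ∀ {s} → Int N s → s ∈ S → ∀ i → ∃ λ x → H.Incident (clique i) x × x ∉ S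
    pure-end {s} is s∈S i with proj₁ (pair i) ∈? S | proj₂ (pair i) ∈? S
    ... | no a∉S  | _       = _ , H.joins-incidentˡ (clique-joins i) , a∉S
    ... | yes _   | no b∉S  = _ , H.joins-incidentʳ (clique-joins i) , b∉S
    ... | yes a∈S | yes b∈S = ⊥-elim (not-three s∈S a∈S b∈S
      (bnd-≢-int (clique-bnd {i} (H.joins-incidentˡ (clique-joins i))) is) (bnd-≢-int (clique-bnd {i} (H.joins-incidentʳ (clique-joins i))) is) (clique-≢ i))

    -- Unshared ends `x` of `i` and `y` of `j` are distinct, and the clique edge joining them makes
    -- `y` or `x` shared, whichever side it lies on.
    clique-not-split : ∀ {s i j} → Int N s → s ∈ S → clique i ∈ Z → clique j ∉ Z → Absurd
    clique-not-split {s} {i} {j} is s∈S i∈Z j∉Z = contra (pure-end is s∈S i) (pure-end is s∈S j)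
      where
      contra : (∃ λ x → H.Incident (clique i) x × x ∉ S) → (∃ λ y → H.Incident (clique j) y × y ∉ S) → Absurd
      contra (x , ix , x∉S) (y , jy , y∉S) with x ≟ y
      ... | yes refl = x∉S (H.∈-shared⁺ i∈Z ix j∉Z jy)
      ... | no x≢y with clique-edge (clique-bnd {i} ix) (clique-bnd {j} jy) x≢y
      ...   | l , lxy with clique l ∈? Z
      ...     | yes l∈Z = y∉S (H.∈-shared⁺ l∈Z (H.joins-incidentʳ lxy) j∉Z jy)
      ...     | no l∉Z  = x∉S (H.∈-shared⁺ i∈Z ix l∉Z (H.joins-incidentˡ lxy))

    module _ (cliques∉Z : ∀ i → clique i ∉ Z) (X : Subset (suc (m (Γ N)))) (e₀∉X : zero ∉ X)
      (∈X⁺ : ∀ {e} → lift e ∈ Z → suc e ∈ X) (∈X⁻ : ∀ {e} → suc e ∈ X → lift e ∈ Z) where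

      -- Every boundary node lies on a clique edge, and these are all outside `Z`.
      boundary-shared : ∀ {e x} → suc e ∈ X → Incident e x → Bnd N x → x ∈ S
      boundary-shared {e} {x} e∈X ex b =
        let (c , bc , c≢x) = otherBnd x
            (i , ixc) = clique-edge b bc (c≢x ∘ sym)
        in H.∈-shared⁺ (∈X⁻ e∈X) (lift-incident⁺ ex) (cliques∉Z i) (H.joins-incidentˡ ixc)

      -- An unshared vertex misses `X` or its complement, and its coordinate functional kills the
      -- side that it misses.
      unshared-zero : ∀ {p} → Annihilates X p → Annihilates (∁ X) p → ∀ x → x ∉ S → p (suc x) ≡ 0ℚ
      unshared-zero {p} annX annY x x∉S with any? (λ e → (suc e ∈? X) ×-dec incident? e x)
      ... | no untouched = coordinate-zero {X} {p} annX x (λ _ e e∈X ex → untouched (e , e∈X , ex))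
      ... | yes (e , e∈X , ex) = coordinate-zero {∁ X} {p} annY x
        (λ _ f f∈ fx → x∉S (H.∈-shared⁺ (∈X⁻ e∈X) (lift-incident⁺ ex) (λ f∈Z → x∈∁p⇒x∉p f∈ (∈X⁺ f∈Z)) (lift-incident⁺ fx)))

      -- The only shared vertex is the interior `s`, so `X` meets no boundary node, and by
      -- `residual-zero` at `s` the spans meet in zero.
      X-not-1-separation : k ≡ 1 → ∀ {e s} → lift e ∈ Z → Int N s → s ∈ S → Absurd
      X-not-1-separation refl {e} {s} e∈Z is s∈S = span-intersection {0} {X} (s≤s (s≤s z≤n))
        (1≤∣p∣ (∈X⁺ e∈Z)) (1≤∣p∣ (x∉p⇒x∈∁p e₀∉X)) [] trivial matroid-connected
        where
        only : ∀ {x} → x ∈ S → x ≡ s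
        only {x} x∈S = decidable-stable (x ≟ s) (λ x≢s → ℕₚ.<⇒≱ (s≤s (s≤s z≤n)) (subst (2 ≤_) ∣S∣≡k (2≤∣p∣ s∈S x∈S x≢s)))

        trivial : ∀ p → Annihilates X p → Annihilates (∁ X) p → All (λ l → l · p ≡ 0ℚ) [] → ∀ t → p t ≡ 0ℚ
        trivial p annX annY [] = residual-zero {X} {p} s e₀∉X (λ e∈X ex b → only (boundary-shared e∈X ex b)) annX
          (λ x _ x≢s → unshared-zero {p} annX annY x (x≢s ∘ only))

      -- Besides `s` there is one more shared vertex `t`. Requiring the coordinate at `s` to vanish
      -- leaves a vector on `t` and e₀, which is zero by `residual-zero`; so the spans meet in
      -- dimension at most 1.
      X-not-2-separation : k ≡ 2 → ∀ {e f s} → lift e ∈ Z → lift f ∉ Z → Int N s → s ∈ S → Absurd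
      X-not-2-separation refl {e} {f} {s} e∈Z f∉Z is s∈S
        with 2≤∣p∣⇒other {p = S} (ℕₚ.≤-reflexive (sym ∣S∣≡k)) s∈S | 2≤∣p∣⇒other {p = Z} (proj₁ sep) e∈Z
      ... | t , t∈S , t≢s | g , g∈Z , g≢e with hatEdge g
      ...   | paired i  = cliques∉Z i g∈Z
      ...   | lifted e' = span-intersection {1} {X} (s≤s (s≤s (s≤s z≤n)))
        (2≤∣p∣ (∈X⁺ e∈Z) (∈X⁺ g∈Z) (λ p → g≢e (cong lift (suc-injective p))))
        (2≤∣p∣ (x∉p⇒x∈∁p e₀∉X) (x∉p⇒x∈∁p (f∉Z ∘ ∈X⁻)) λ ())
        (unit (suc s) ∷ []) trivial matroid-connected
        where
        only : ∀ {x} → x ∈ S → x ≢ s → x ≡ t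
        only {x} x∈S x≢s = decidable-stable (x ≟ t) (not-three s∈S t∈S x∈S t≢s x≢s)

        trivial : ∀ p → Annihilates X p → Annihilates (∁ X) p → All (λ l → l · p ≡ 0ℚ) (unit (suc s) ∷ []) → ∀ t → p t ≡ 0ℚ
        trivial p annX annY (ps ∷ []) = residual-zero {X} {p} t e₀∉X
          (λ e∈X ex b → only (boundary-shared e∈X ex b) (bnd-≢-int b is)) annX interior
          where
          interior : ∀ x → Int N x → x ≢ t → p (suc x) ≡ 0ℚ
          interior x _ x≢t with x ≟ s
          ... | yes refl = trans (sym (unit-· (suc s) p)) ps
          ... | no x≢s   = unshared-zero {p} annX annY x (λ x∈S → x≢t (only x∈S x≢s))

    cliques-outside : 1 ≤ k → (∀ i → clique i ∉ Z) → ∀ {e f s} → lift e ∈ Z → lift f ∉ Z → Int N s → s ∈ S → Absurd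
    cliques-outside 1≤k cliques∉Z e∈Z f∉Z is s∈S = [ (λ k≡1 → X-not-1-separation cliques∉Z X (λ ()) ∈X⁺ ∈X⁻ k≡1 e∈Z is s∈S)
      , (λ k≡2 → X-not-2-separation cliques∉Z X (λ ()) ∈X⁺ ∈X⁻ k≡2 e∈Z f∉Z is s∈S) ]′ (one-or-two 1≤k k<3)
      where
      one-or-two : ∀ {k} → 1 ≤ k → k < 3 → k ≡ 1 ⊎ k ≡ 2
      one-or-two {1} _ _ = inj₁ refl
      one-or-two {2} _ _ = inj₂ refl
      one-or-two {suc (suc (suc _))} _ (s≤s (s≤s (s≤s ())))

      -- e₀ goes to the side of the clique edges.
      X : Subset (suc (m (Γ N)))
      X = false ∷ tabulate (λ e → lookup Z (lift e))

      ∈X⁺ : ∀ {e} → lift e ∈ Z → suc e ∈ X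
      ∈X⁺ {e} e∈Z = there (lookup⇒[]= e _ (trans (lookup∘tabulate (λ e → lookup Z (lift e)) e) ([]=⇒lookup e∈Z)))

      ∈X⁻ : ∀ {e} → suc e ∈ X → lift e ∈ Z
      ∈X⁻ {e} (there e∈) = lookup⇒[]= (lift e) Z (trans (sym (lookup∘tabulate (λ e → lookup Z (lift e)) e)) ([]=⇒lookup e∈))

  -- Once a side made of clique edges alone is excluded, `clique-not-split` puts the clique on one
  -- side, and complementation puts it outside `Z`.
  no-separation : ∀ k Z → 1 ≤ k → k < 3 → ¬ GraphSeparation (hatΓ N) k Z
  no-separation k Z 1≤k k<3 sep with any? (λ e → lift e ∈? Z) | any? (λ e → ¬? (lift e ∈? Z))
  ... | _ | no none = HatSeparation.not-all-in-Z Z k<3 sep 1≤k (λ e → decidable-stable (lift e ∈? Z) (λ e∉ → none (e , e∉)))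
  ... | no none | _ = HatSeparation.not-all-in-Z (∁ Z) k<3 (H.separation-∁ {k} {Z} sep) 1≤k (λ e → x∉p⇒x∈∁p (λ e∈ → none (e , e∈)))
  ... | yes (e , e∈Z) | yes (f , f∉Z) = split (any? (λ i → clique i ∈? Z)) (any? (λ i → ¬? (clique i ∈? Z)))
    where
    split : Dec (∃ λ i → clique i ∈ Z) → Dec (∃ λ i → clique i ∉ Z) → Absurd
    split (no none) _ =
      let (s , is , s∈S) = HatSeparation.mixed-interior Z k<3 sep e∈Z f∉Z
      in HatSeparation.cliques-outside Z k<3 sep 1≤k (λ i i∈ → none (i , i∈)) e∈Z f∉Z is s∈S
    split _ (no none) =
      let sep′ = H.separation-∁ {k} {Z} sep
          e∉∁Z = λ e∈∁ → x∈p⇒x∉∁p e∈Z e∈∁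
          (s , is , s∈S) = HatSeparation.mixed-interior (∁ Z) k<3 sep′ (x∉p⇒x∈∁p f∉Z) e∉∁Z
      in HatSeparation.cliques-outside (∁ Z) k<3 sep′ 1≤k (λ i i∈∁ → none (i , x∈∁p⇒x∉p i∈∁)) (x∉p⇒x∈∁p f∉Z) e∉∁Z is s∈S
    split (yes (i , i∈Z)) (yes (j , j∉Z)) =
      let (s , is , s∈S) = HatSeparation.mixed-interior Z k<3 sep e∈Z f∉Z
      in HatSeparation.clique-not-split Z k<3 sep is s∈S i∈Z j∉Z

  hat-walk : ∀ {x y} → Walk (Γ N) (λ _ → Unit) x y → Walk (hatΓ N) (λ _ → Unit) x y
  hat-walk (here _)      = here tt
  hat-walk (stepF {w} e _ p) = subst₂ (λ x y → Walk (hatΓ N) (λ _ → Unit) y w → Walk (hatΓ N) (λ _ → Unit) x w)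
    (src-lift e) (tgt-lift e) (stepF (lift e) tt) (hat-walk p)
  hat-walk (stepB {w} e _ p) = subst₂ (λ x y → Walk (hatΓ N) (λ _ → Unit) x w → Walk (hatΓ N) (λ _ → Unit) y w)
    (src-lift e) (tgt-lift e) (stepB (lift e) tt) (hat-walk p)

  hat-3-connected : GraphTutte3Connected (hatΓ N)
  hat-3-connected = ((i₀ , _) , λ x y _ _ → hat-walk (proj₂ Γ-connected x y _ _)) , no-separation

theorem1p3 : (N : Network) → IsNetwork N
    → (u : Fin (n (Γ N)) → ℚ) → InjectiveOnB N u
    → Matroid3Connected (DirichletIndep N u)
    ⇔ (InteriorConnected N × GraphTutte3Connected (hatΓ N))
theorem1p3 N net u u-inj = mk⇔
  (λ connected → Necessity.interior-connected N net u u-inj connected , Necessity.hat-3-connected N net u u-inj connected)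
  (λ (interior , hat) → Sufficiency.matroid-3-connected N net u u-inj interior hat)
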